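{- Let $G$ be a graph with vertex cover number $r$. Then the WL dimension of $G$ is at most $\frac{2}{3}r+3$.
   Context: Graphs are finite, simple, undirected with non-empty vertex set. A vertex cover of $G$ is a set $S\subseteq V(G)$ meeting every edge; the vertex cover number is the minimum size of a vertex cover. For $k\ge 1$, the $k$-dimensional Weisfeiler--Leman algorithm ($k$-WL) colors $V(G)^k$: initially two $k$-tuples $(v_1,\dots,v_k)$, $(w_1,\dots,w_k)$ (possibly from different graphs) get the same color iff $v_i\mapsto w_i$ is an isomorphism of the induced (colored) subgraphs; in each round, for $k\ge2$, the new color of $\bar v$ is the pair of its old color and the multiset over $w\in V(G)$ of the tuples (old color of $\bar v[w/1]$,\dots, old color of $\bar v[w/k]$), where $\bar v[w/i]$ replaces the $i$-th entry by $w$; for $k=1$ the new color of $v$ is its old color together with the multiset of old colors of its neighbors. Iterate until stable; colors are canonical. $k$-WL identifies $G$ if for every graph $H\not\cong G$ the multisets of stable colors of $k$-tuples of $G$ and $H$ differ. The WL dimension of $G$ is the least $k\ge1$ such that $k$-WL identifies $G$. -}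

module Defs where

open import Data.Nat using (ℕ; zero; suc; _≤_; _<_)
open import Data.Fin using (Fin)
open import Data.Fin.Subset using (Subset; _∈_; ∣_∣)
open import Data.Bool using (Bool; true; false; T)
open import Data.Vec using (Vec; lookup; head; _[_]≔_; [_])
open import Data.Product using (Σ; _×_; ∃; proj₁)
open import Data.Sum using (_⊎_)
open import Relation.Nullary using (¬_)
open import Relation.Binary.PropositionalEquality using (_≡_)
open import Function.Bundles using (_↔_; _⇔_; Inverse)

record Graph : Set where
  field
    size     : ℕ
    nonempty : 1 ≤ size
    adj      : Fin size → Fin size → Bool
    adj-sym  : ∀ u v → adj u v ≡ adj v u
    adj-irr  : ∀ v → adj v v ≡ false

open Graph public

V : Graph → Set
V G = Fin (size G)

N : (G : Graph) → V G → Set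
N G v = Σ (V G) (λ u → T (adj G v u))

Iso : Graph → Graph → Set
Iso G H = Σ (V G ↔ V H) λ π →
  ∀ u v → adj G u v ≡ adj H (Inverse.to π u) (Inverse.to π v)

IsVertexCover : (G : Graph) → Subset (size G) → Set
IsVertexCover G S = ∀ u v → T (adj G u v) → (u ∈ S) ⊎ (v ∈ S)

VertexCoverNumber : Graph → ℕ → Set
VertexCoverNumber G r =
  (Σ (Subset (size G)) λ S → IsVertexCover G S × ∣ S ∣ ≡ r)
  × (∀ S → IsVertexCover G S → r ≤ ∣ S ∣)

-- Initial colour agreement of k-tuples (possibly of different graphs):
-- v_i ↦ w_i is an isomorphism of the induced subgraphs, i.e. the
-- equality type and the adjacency type of the tuples agree.
AtomEq : (k : ℕ) (G H : Graph) → Vec (V G) k → Vec (V H) k → Set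
AtomEq k G H v w = ∀ i j →
  ((lookup v i ≡ lookup v j) ⇔ (lookup w i ≡ lookup w j))
  × (adj G (lookup v i) (lookup v j) ≡ adj H (lookup w i) (lookup w j))

-- SameColour k t G H v w : the k-tuple v of G and the k-tuple w of H
-- receive the same colour after t rounds of k-WL.
-- Multiset equality is expressed by a colour-preserving bijection.
SameColour : (k t : ℕ) (G H : Graph) → Vec (V G) k → Vec (V H) k → Set
SameColour k zero G H v w = AtomEq k G H v w
SameColour (suc zero) (suc t) G H v w =
  SameColour 1 t G H v w
  × Σ (N G (head v) ↔ N H (head w)) λ π →
      ∀ x → SameColour 1 t G H [ proj₁ x ] [ proj₁ (Inverse.to π x) ]
SameColour k (suc t) G H v w =
  SameColour k t G H v w
  × Σ (V G ↔ V H) λ π →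
      ∀ u i → SameColour k t G H (v [ i ]≔ u) (w [ i ]≔ Inverse.to π u)

SameMultiset : (k t : ℕ) (G H : Graph) → Set
SameMultiset k t G H =
  Σ (Vec (V G) k ↔ Vec (V H) k) λ σ → ∀ v → SameColour k t G H v (Inverse.to σ v)

-- k-WL identifies G: every non-isomorphic H is distinguished, i.e. at
-- some round the colour multisets differ (equivalently, the stable ones do).
Identifies : ℕ → Graph → Set
Identifies k G = ∀ H → ¬ Iso G H → ∃ λ t → ¬ SameMultiset k t G H

IsWLDimension : Graph → ℕ → Set
IsWLDimension G d =
  1 ≤ d × Identifies d G × (∀ k → 1 ≤ k → k < d → ¬ Identifies k G)

{-# OPTIONS --safe #-}
-- Let S be a vertex cover of size r and suppose that k-WL, k = 3 + ⌊2r/3⌋, does not distinguish G from H.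
-- Stable k-tuple colours give a winning strategy in the bijective pebble game on G and H.  Each position of
-- that game induces an equitable partition of V G, in which pebbled vertices are singletons.  A class that
-- meets S scores 2 if it lies inside S and 1 if it is mixed, so no position scores more than 2r.  Place pebbles
-- as long as one pebble gains 3 points or two pebbles gain 6; this uses at most 2r/3 pebbles.
-- At a saturated position the partition is rigid, because any further asymmetry could be pebbled for a gain:
-- all pairs of classes are homogeneous, except that a class outside S may hang off one class inside S as
-- leaves (or co-leaves), each with a single centre, and that mixed vertices may be joined by a
-- matching.  Such a structure is determined by its degrees, which the game preserves; hence G ≅ H.
-- The WL dimension itself is found by search: colour sequences on finite sets stabilise, so it is decidable
-- whether k-WL identifies G.
module Submission where

open import Defs
open import Data.Bool using (Bool; true; false; T; _∧_; _∨_; not)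
import Data.Bool.Properties as Bool
open import Data.Empty using (⊥; ⊥-elim)
open import Data.Fin using (Fin; zero; suc; fromℕ<; punchOut)
open import Data.Fin.Permutation using (↔⇒≡)
open import Data.Fin.Permutation.Components using (transpose; transpose-inverse)
open import Data.Fin.Properties using (_≟_; any?; all?; ∀-cons; ¬∀⟶∃¬; injective⇒≤; punchOut-injective; *↔×)
open import Data.Fin.Subset using (Subset; ∣_∣; _∈_; _-_)
open import Data.Fin.Subset.Properties using (x∈p∧x≢y⇒x∈p-y; x∈p⇒∣p-x∣<∣p∣)
open import Data.List using (List; []; _∷_; _++_; length; allFin; filter)
import Data.List as List
import Data.List.Membership.DecPropositional as DecMembership
import Data.List.Membership.Propositional as List
open import Data.List.Membership.Propositional.Properties using (∈-allFin; ∈-filter⁺; ∈-map⁺)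
open import Data.List.Properties using (length-++; filter-notAll)
open import Data.List.Relation.Unary.All as All using (All; []; _∷_)
import Data.List.Relation.Unary.All.Properties as All
open import Data.List.Relation.Unary.AllPairs as AllPairs using (AllPairs; []; _∷_)
open import Data.List.Relation.Unary.Any as Any using (here; there)
open import Data.List.Relation.Unary.Any.Properties using (lookup-index)
open import Data.Nat using (ℕ; zero; suc; _≤_; _<_; _*_; _+_; _^_; _/_; z≤n; s≤s)
open import Data.Nat.DivMod using (m/n*n≤m; m*n/n≡m; /-monoˡ-≤)
import Data.Nat.Properties as ℕ
open import Data.Nat.Properties using (≤-refl; ≤-trans; ≤-reflexive; ≤-pred; m≤m+n; n≤1+n; m≤n⇒m≤1+n; 1+n≰n; <⇒≱; <⇒≢; +-mono-≤; +-comm; +-suc; *-suc; *-comm; *-distribˡ-+)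
open import Algebra.Properties.CommutativeSemigroup ℕ.+-commutativeSemigroup using (interchange)
open import Data.Product using (Σ; ∃; _×_; _,_; proj₁; proj₂)
open import Data.Product.Function.NonDependent.Propositional using (_×-↔_)
open import Data.Sum using (_⊎_; inj₁; inj₂)
open import Data.Unit using (tt)
open import Data.Vec as Vec using (Vec; []; _∷_; lookup; _[_]≔_; tabulate; head; replicate)
import Data.Vec.Properties as Vec
open import Function using (_∘_; _↔_; _⇔_; Inverse; Equivalence; Injective; mk↔ₛ′; mk⇔)
open import Function.Construct.Composition using (_↔-∘_)
open import Function.Construct.Symmetry using (↔-sym)
open import Relation.Binary.Construct.Closure.ReflexiveTransitive as Star using (Star; ε; _◅_; _◅◅_)
open import Relation.Binary.Definitions using (tri<; tri≈; tri>)
open import Relation.Binary.PropositionalEquality using (_≡_; _≢_; refl; sym; trans; cong; cong₂; subst)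
open import Relation.Nullary using (¬_; Dec; yes; no; contradiction)
open import Relation.Nullary.Decidable using (decidable-stable; ¬¬-excluded-middle; map′; _×-dec_; _⊎-dec_; _→-dec_; ¬?; does; dec-true; dec-false)

open Inverse using (to; from; strictlyInverseˡ; strictlyInverseʳ)

-- Stability under double negation and pigeonhole principles on finite sets.

bool-stable : {a b : Bool} → ¬ ¬ (a ≡ b) → a ≡ b
bool-stable = decidable-stable (_ Bool.≟ _)

fin-stable : ∀ {n} {i j : Fin n} → ¬ ¬ (i ≡ j) → i ≡ j
fin-stable = decidable-stable (_ ≟ _)

true≢false : {b : Bool} → b ≡ true → b ≡ false → ⊥
true≢false refl ()

≢true⇒≡false : {b : Bool} → b ≢ true → b ≡ false
≢true⇒≡false = Bool.¬-not

bool-ext : {a b : Bool} → (a ≡ true → b ≡ true) → (b ≡ true → a ≡ true) → a ≡ b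
bool-ext {false} {false} f g = refl
bool-ext {false} {true}  f g = g refl
bool-ext {true}  {b}     f g = sym (f refl)

¬¬-Π-fin : ∀ {n} {P : Fin n → Set} → (∀ i → ¬ ¬ P i) → ¬ ¬ (∀ i → P i)
¬¬-Π-fin {zero}  h k = k λ ()
¬¬-Π-fin {suc n} h k = h zero λ p → ¬¬-Π-fin (h ∘ suc) λ ps → k (∀-cons p ps)

injective⇒surjective : ∀ {n} (f : Fin n → Fin n) → Injective _≡_ _≡_ f → ∀ y → ∃ λ x → f x ≡ y
injective⇒surjective {suc n} f inj y with any? (λ x → f x ≟ y)
... | yes p = p
... | no ¬p = contradiction
  (injective⇒≤ {f = λ x → punchOut {i = y} (λ eq → ¬p (x , sym eq))}
    (λ {x} {z} eq → inj (punchOut-injective (λ e → ¬p (x , sym e)) (λ e → ¬p (z , sym e)) eq)))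
  1+n≰n

module _ {n : ℕ} {A : Fin n → Set} (A? : ∀ x → Dec (A x)) (g : Fin n → Fin n)
         (closed : ∀ {x} → A x → A (g x)) (inj : ∀ {x y} → A x → A y → g x ≡ g y → x ≡ y) where

  private
    extend : Fin n → Fin n
    extend x with A? x
    ... | yes _ = g x
    ... | no  _ = x

    extend-injective : Injective _≡_ _≡_ extend
    extend-injective {x} {y} eq with A? x | A? y
    ... | yes p | yes q = inj p q eq
    ... | yes p | no ¬q = contradiction (subst A eq (closed p)) ¬q
    ... | no ¬p | yes q = contradiction (subst A (sym eq) (closed q)) ¬p
    ... | no ¬p | no ¬q = eq

  -- Continued by the identity outside `A`, the map `g` is an injection of the whole finite set.
  -- Degrees are compared below in this form, without counting.
  injective-on⇒surjective-on : ∀ {c} → A c → ∃ λ y → A y × g y ≡ c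
  injective-on⇒surjective-on {c} pc with injective⇒surjective extend extend-injective c
  ... | x , eq with A? x
  ...   | yes p = x , p , eq
  ...   | no ¬p = contradiction (subst A (sym eq) pc) ¬p

transpose-cases : ∀ {n} (i j k : Fin n) →
  (k ≡ i × transpose i j k ≡ j) ⊎ (k ≡ j × transpose i j k ≡ i) ⊎ (k ≢ i × k ≢ j × transpose i j k ≡ k)
transpose-cases i j k with k ≟ i
... | yes p = inj₁ (p , refl)
... | no ¬p with k ≟ j
...   | yes q = inj₂ (inj₁ (q , refl))
...   | no ¬q = inj₂ (inj₂ (¬p , ¬q , refl))

transpose-injective : ∀ {n} (i j : Fin n) → Injective _≡_ _≡_ (transpose i j)
transpose-injective i j eq =
  trans (sym (transpose-inverse j i)) (trans (cong (transpose j i) eq) (transpose-inverse j i))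

-- Adjacency and equitable bijections.

adj-irrefl-≢ : (G : Graph) {u v : V G} → adj G u v ≡ true → u ≢ v
adj-irrefl-≢ G {u} a refl = true≢false a (adj-irr G u)

-- A bijection along ρ that carries the neighbourhood of u onto that of w: the statement that ρ is equitable.
record Match (X Y : Graph) (ρ : V X → V Y → Set) (u : V X) (w : V Y) : Set where
  field
    fwd     : V X → V Y
    bwd     : V Y → V X
    fwd-bwd : ∀ y → fwd (bwd y) ≡ y
    bwd-fwd : ∀ x → bwd (fwd x) ≡ x
    related : ∀ x → ρ x (fwd x)
    adjacent : ∀ x → adj X u x ≡ adj Y w (fwd x)
    base    : fwd u ≡ w

  fwd-injective : ∀ {x y} → fwd x ≡ fwd y → x ≡ y
  fwd-injective {x} {y} eq = trans (sym (bwd-fwd x)) (trans (cong bwd eq) (bwd-fwd y))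

  bwd-injective : ∀ {x y} → bwd x ≡ bwd y → x ≡ y
  bwd-injective {x} {y} eq = trans (sym (fwd-bwd x)) (trans (cong fwd eq) (fwd-bwd y))

  related-bwd : ∀ y → ρ (bwd y) y
  related-bwd y = subst (ρ (bwd y)) (fwd-bwd y) (related (bwd y))

  adjacent-bwd : ∀ y → adj X u (bwd y) ≡ adj Y w y
  adjacent-bwd y = trans (adjacent (bwd y)) (cong (adj Y w) (fwd-bwd y))

open Match

match-id : ∀ {X ρ u} → (∀ x → ρ x x) → Match X X ρ u u
match-id r = record
  { fwd = λ x → x ; bwd = λ x → x ; fwd-bwd = λ _ → refl ; bwd-fwd = λ _ → refl
  ; related = r ; adjacent = λ _ → refl ; base = refl }

match-sym : ∀ {X Y ρ u w} → Match X Y ρ u w → Match Y X (λ y x → ρ x y) w u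
match-sym M = record
  { fwd = bwd M ; bwd = fwd M ; fwd-bwd = bwd-fwd M ; bwd-fwd = fwd-bwd M
  ; related = related-bwd M ; adjacent = λ y → sym (adjacent-bwd M y)
  ; base = trans (cong (bwd M) (sym (base M))) (bwd-fwd M _) }

match-trans : ∀ {X Y Z ρ ρ′ ρ″ u v w} → (∀ {x y z} → ρ x y → ρ′ y z → ρ″ x z) →
  Match X Y ρ u v → Match Y Z ρ′ v w → Match X Z ρ″ u w
match-trans t M N = record
  { fwd = λ x → fwd N (fwd M x) ; bwd = λ z → bwd M (bwd N z)
  ; fwd-bwd = λ z → trans (cong (fwd N) (fwd-bwd M _)) (fwd-bwd N z)
  ; bwd-fwd = λ x → trans (cong (bwd M) (bwd-fwd N _)) (bwd-fwd M x)
  ; related = λ x → t (related M x) (related N (fwd M x))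
  ; adjacent = λ x → trans (adjacent M x) (adjacent N (fwd M x))
  ; base = trans (cong (fwd N) (base M)) (base N) }

-- The bijective pebble game and the partitions it induces.

module Game
  (G H : Graph) (k : ℕ) (E : List (V G × V H) → Set)
  (ext : ∀ {ps} → E ps → length ps < k → Σ (V G ↔ V H) λ π → ∀ u → E ((u , Inverse.to π u) ∷ ps))
  (drop₂ : ∀ {p q ps} → E (p ∷ q ∷ ps) → E (p ∷ ps))
  (atom : ∀ {a a′ b b′ ps} → E ((a , a′) ∷ (b , b′) ∷ ps) →
    ((a ≡ b) ⇔ (a′ ≡ b′)) × adj G a b ≡ adj H a′ b′)
  where

  Pos : Set
  Pos = List (V G × V H)

  -- Two vertices of G are identified when they can be answered by the same vertex of H; the classes of the
  -- generated equivalence are the cells of the partition at position ps.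
  Step : Pos → V G → V G → Set
  Step ps u v = ∃ λ w → E ((u , w) ∷ ps) × E ((v , w) ∷ ps)

  infix 4 _≈[_]_ _⋈[_]_
  _≈[_]_ : V G → Pos → V G → Set
  u ≈[ ps ] v = Star (Step ps) u v

  ≈-sym : ∀ {ps u v} → u ≈[ ps ] v → v ≈[ ps ] u
  ≈-sym = Star.reverse λ { (w , e , e′) → w , e′ , e }

  ≈-drop : ∀ {p ps u v} → u ≈[ p ∷ ps ] v → u ≈[ ps ] v
  ≈-drop = Star.map λ { (w , e , e′) → w , drop₂ e , drop₂ e′ }

  -- Both ends of a link share an answer `w`, and whether `w` is adjacent to `z` decides adjacency
  -- to `x` for both of them.
  ≈-adj : ∀ {x z ps u v} → u ≈[ (x , z) ∷ ps ] v → adj G x u ≡ adj G x v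
  ≈-adj ε = refl
  ≈-adj {x} {z} ((w , e , e′) ◅ c) = trans
    (trans (adj-sym G x _) (trans (trans (proj₂ (atom e)) (sym (proj₂ (atom e′)))) (adj-sym G _ x)))
    (≈-adj c)

  ≈-pebble : ∀ {x z ps u} → u ≈[ (x , z) ∷ ps ] x → u ≡ x
  ≈-pebble ε = refl
  ≈-pebble ((w , e , e′) ◅ c) with ≈-pebble c
  ... | refl = Equivalence.from (proj₁ (atom e)) (Equivalence.to (proj₁ (atom e′)) refl)

  -- With (u, w) on the board, the answer to one further pebble is a bijection that carries
  -- neighbours of `u` to neighbours of `w`. Forgetting the pebble (u, w) afterwards leaves the
  -- relation at `ps`.
  cross : ∀ {ps u w} → E ((u , w) ∷ ps) → suc (length ps) < k →
    Match G H (λ v z → E ((v , z) ∷ ps)) u w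
  cross {ps} {u} {w} e l = record
    { fwd = Inverse.to π ; bwd = Inverse.from π
    ; fwd-bwd = Inverse.strictlyInverseˡ π ; bwd-fwd = Inverse.strictlyInverseʳ π
    ; related = λ v → drop₂ (e′ v)
    ; adjacent = λ v → trans (adj-sym G u v) (trans (proj₂ (atom (e′ v))) (adj-sym H _ w))
    ; base = Equivalence.to (proj₁ (atom (e′ u))) refl }
    where
    π  = proj₁ (ext e l)
    e′ = proj₂ (ext e l)

  abstract
    -- Two vertices with a common answer are compared by crossing to `H` and back; along a chain
    -- these bijections compose.
    equitable : ∀ {ps u v} → suc (length ps) < k → u ≈[ ps ] v → Match G G (_≈[ ps ]_) u v
    equitable l ε = match-id λ _ → ε
    equitable l ((w , e , e′) ◅ c) =
      match-trans _◅_ (match-trans (λ a b → _ , a , b) (cross e l) (match-sym (cross e′ l))) (equitable l c)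

  -- The correspondence between classes of `G` and classes of `H`, expressed on their members.
  _⋈[_]_ : V G → Pos → V H → Set
  u ⋈[ ps ] w = ∃ λ u′ → u ≈[ ps ] u′ × E ((u′ , w) ∷ ps)

  abstract
    ⋈-equitable : ∀ {ps u w} → suc (length ps) < k → u ⋈[ ps ] w → Match G H (_⋈[ ps ]_) u w
    ⋈-equitable l (u′ , c , e) = match-trans (λ a b → _ , a , b) (equitable l c) (cross e l)

  ⋈-join : ∀ {ps u v w} → u ⋈[ ps ] w → v ⋈[ ps ] w → u ≈[ ps ] v
  ⋈-join (_ , c , e) (_ , c′ , e′) = c ◅◅ ((_ , e , e′) ◅ ≈-sym c′)

  ≈-⋈ : ∀ {ps u v w} → u ≈[ ps ] v → v ⋈[ ps ] w → u ⋈[ ps ] w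
  ≈-⋈ c (v′ , c′ , e) = v′ , c ◅◅ c′ , e

  -- Scores of positions and saturation.

  module Cover
    (s : V G → Bool)
    (cover : ∀ {u v} → adj G u v ≡ true → s u ≡ true ⊎ s v ≡ true)
    (r : ℕ) (bound : ∀ L → AllPairs _≢_ L → All (λ v → s v ≡ true) L → length L ≤ r)
    where

    InS : V G → Set
    InS v = s v ≡ true

    Pure : Pos → V G → Set
    Pure ps u = ∀ v → v ≈[ ps ] u → InS v

    Pure-drop : ∀ {p ps u} → Pure ps u → Pure (p ∷ ps) u
    Pure-drop h v c = h v (≈-drop c)

    Pure-resp : ∀ {ps u v} → u ≈[ ps ] v → Pure ps v → Pure ps u
    Pure-resp c h x d = h x (d ◅◅ c)

    Apart : Pos → List (V G) → Set
    Apart ps = AllPairs (λ a b → ¬ a ≈[ ps ] b)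

    -- T picks classes meeting S and P picks classes inside S, so the latter are counted twice.
    Score : Pos → ℕ → Set
    Score ps m = Σ (List (V G)) λ T → Σ (List (V G)) λ P →
      (Apart ps T × All InS T) × (Apart ps P × All (Pure ps) P) × m ≤ length T + length P

    Apart⇒distinct : ∀ {ps L} → Apart ps L → AllPairs _≢_ L
    Apart⇒distinct = AllPairs.map λ { ¬c refl → ¬c ε }

    Score-bound : ∀ {ps m} → Score ps m → m ≤ r + r
    Score-bound (T , P , (aT , iT) , (aP , iP) , le) = ≤-trans le (+-mono-≤
      (bound T (Apart⇒distinct aT) iT)
      (bound P (Apart⇒distinct aP) (All.map (λ h → h _ ε) iP)))

    module _ {ps ps′ : Pos} (coarser : ∀ {a b} → a ≈[ ps′ ] b → a ≈[ ps ] b) where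

      -- Representatives of the old classes are moved inside their classes so as to avoid the new classes of As.
      enlarge : (Q Q′ : V G → Set) → (∀ {a} → Q a → Q′ a) →
        ∀ As → Apart ps′ As → All Q′ As →
        All (λ a → ∀ t → Q t → t ≈[ ps′ ] a → ∃ λ b → Q b × b ≈[ ps ] t × All (λ a′ → ¬ b ≈[ ps′ ] a′) As) As →
        ∀ T → Apart ps T → All Q T →
        ¬ ¬ Σ (List (V G)) λ T′ → Apart ps′ T′ × All Q′ T′ × length T′ ≡ length As + length T
      enlarge Q Q′ Q⇒Q′ As apAs qAs avoid T apT qT k =
        move T apT qT λ { (T′ , apT′ , qT′ , avT′ , _ , eq) → k
          ( T′ ++ As , apart-++ apT′ avT′ , All.++⁺ (All.map Q⇒Q′ qT′) qAs
          , trans (length-++ T′) (trans (cong (_+ length As) eq) (+-comm (length T) (length As)))) }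
        where
        Away : V G → Set
        Away b = All (λ a′ → ¬ b ≈[ ps′ ] a′) As

        move₁ : ∀ t → Q t → ¬ ¬ ∃ λ b → Q b × b ≈[ ps ] t × Away b
        move₁ t q k = ¬¬-Any avoid λ
          { (inj₁ away) → k (t , q , ε , away)
          ; (inj₂ (a , f , c)) → k (f t q c) }
          where
          ¬¬-Any : ∀ {P : V G → Set} {L} → All P L →
            ¬ ¬ (All (λ a → ¬ t ≈[ ps′ ] a) L ⊎ ∃ λ a → P a × t ≈[ ps′ ] a)
          ¬¬-Any [] k = k (inj₁ [])
          ¬¬-Any {L = a ∷ L} (p ∷ ps) k = ¬¬-excluded-middle λ
            { (yes c) → k (inj₂ (a , p , c))
            ; (no ¬c) → ¬¬-Any ps λ { (inj₁ h) → k (inj₁ (¬c ∷ h)) ; (inj₂ h) → k (inj₂ h) } }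

        move : ∀ T → Apart ps T → All Q T → ¬ ¬ Σ (List (V G)) λ T′ →
          Apart ps T′ × All Q T′ × All Away T′ ×
          -- This clause carries apartness over from `T` to `T′`; it keeps the moved head apart from
          -- the moved tail.
          (∀ t → All (λ x → ¬ t ≈[ ps ] x) T → All (λ x → ¬ t ≈[ ps ] x) T′) × length T′ ≡ length T
        move [] [] [] k = k ([] , [] , [] , [] , (λ _ h → h) , refl)
        move (t ∷ T) (a ∷ ap) (q ∷ qs) k =
          move₁ t q λ { (b , qb , c , away) →
          move T ap qs λ { (T′ , ap′ , qs′ , aways , tr , eq) →
          k ( b ∷ T′
            , All.map (λ ¬d d → ¬d (≈-sym c ◅◅ d)) (tr t a) ∷ ap′
            , qb ∷ qs′ , away ∷ aways
            , (λ { x (h ∷ hs) → (λ d → h (d ◅◅ c)) ∷ tr x hs })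
            , cong suc eq) } }

        apart-++ : ∀ {T′} → Apart ps T′ → All Away T′ → Apart ps′ (T′ ++ As)
        apart-++ [] [] = apAs
        apart-++ (a ∷ ap) (w ∷ ws) = All.++⁺ (All.map (λ ¬c c → ¬c (coarser c)) a) w ∷ apart-++ ap ws

      -- The new classes can be appended to the old lists as long as the old classes they are cut
      -- from keep another representative. A class that only now becomes pure needs no substitute in
      -- the second list, since it contains no old pure representative.
      gain : ∀ {m} → Score ps m → ∀ As Ps →
        Apart ps′ As →
        All (λ a → InS a × ∃ λ b → InS b × b ≈[ ps ] a × All (λ a′ → ¬ b ≈[ ps′ ] a′) As) As →
        Apart ps′ Ps →
        All (λ a → Pure ps′ a × (Pure ps a → ∃ λ b → b ≈[ ps ] a × All (λ a′ → ¬ b ≈[ ps′ ] a′) Ps)) Ps →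
        ¬ ¬ Score ps′ (length As + length Ps + m)
      gain {m} (T , P , (aT , iT) , (aP , iP) , le) As Ps apA hA apP hP k =
        enlarge InS InS (λ q → q) As apA (All.map proj₁ hA)
          (All.map (λ { (_ , b , ib , c , av) t _ d → b , ib , c ◅◅ ≈-sym (coarser d) , av }) hA) T aT iT
          λ { (T′ , aT′ , iT′ , eT) →
        enlarge (Pure ps) (Pure ps′) (λ h v c → h v (coarser c)) Ps apP (All.map proj₁ hP)
          (All.map (λ { (_ , f) t pt d →
            let c = coarser d ; b , e , av = f (Pure-resp (≈-sym c) pt)
            in b , Pure-resp (e ◅◅ ≈-sym c) pt , e ◅◅ ≈-sym c , av }) hP) P aP iP
          λ { (P′ , aP′ , iP′ , eP) →
        k ( T′ , P′ , (aT′ , iT′) , (aP′ , iP′)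
          , ≤-trans (+-mono-≤ (≤-refl {length As + length Ps}) le)
              (≤-reflexive (trans (interchange (length As) (length Ps) (length T) (length P)) (sym (cong₂ _+_ eT eP))))) } }

    record Saturated (ps : Pos) : Set where
      field
        score  : ℕ
        legal  : E ps
        scored : Score ps score
        short  : 3 * length ps ≤ score
        no-3   : ∀ {p} → E (p ∷ ps) → ¬ Score (p ∷ ps) (3 + score)
        no-6   : ∀ {p q} → E (q ∷ p ∷ ps) → ¬ Score (q ∷ p ∷ ps) (6 + score)

    saturate : E [] → ¬ ¬ ∃ Saturated
    -- Fuel plus score stays at least 2r + 1, which exceeds every possible score, so the fuel cannot
    -- run out.
    saturate e₀ k = go (suc (r + r)) [] 0 e₀ ([] , [] , ([] , []) , ([] , []) , z≤n) z≤n (m≤m+n _ 0)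
      where
      3*suc : ∀ l {m} → 3 * l ≤ m → 3 * suc l ≤ 3 + m
      3*suc l h = ≤-trans (≤-reflexive (*-suc 3 l)) (+-mono-≤ (≤-refl {3}) h)

      go : ∀ fuel ps m → E ps → Score ps m → 3 * length ps ≤ m → suc (r + r) ≤ fuel + m → ⊥
      go zero ps m e sc h f = 1+n≰n (≤-trans f (Score-bound sc))
      go (suc fuel) ps m e sc h f = k (ps , record
        { score = m ; legal = e ; scored = sc ; short = h
        ; no-3 = λ e′ sc′ → go fuel _ (3 + m) e′ sc′ (3*suc (length ps) h)
            (≤-trans f (≤-trans (≤-reflexive (sym (+-suc fuel m))) (+-mono-≤ (≤-refl {fuel}) (m≤n⇒m≤1+n (n≤1+n _)))))
        ; no-6 = λ e′ sc′ → go fuel _ (6 + m) e′ sc′ (3*suc (suc (length ps)) (3*suc (length ps) h))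
            (≤-trans f (≤-trans (≤-reflexive (sym (+-suc fuel m)))
              (+-mono-≤ (≤-refl {fuel}) (m≤n⇒m≤1+n (m≤n⇒m≤1+n (m≤n⇒m≤1+n (m≤n⇒m≤1+n (n≤1+n _)))))))) })

    -- What a single pebble cannot do at a saturated position.

    module Structure {ps : Pos} (sat : Saturated ps) (len : 3 + length ps ≤ k) where
      open Saturated sat

      len₁ : suc (length ps) < k
      len₁ = ≤-trans (n≤1+n _) len

      infix 4 _≈_ _≈₁[_]_
      _≈_ : V G → V G → Set
      u ≈ v = u ≈[ ps ] v

      transport : ∀ {u v} → u ≈ v → Match G G _≈_ u v
      transport = equitable len₁

      π : V G ↔ V H
      π = proj₁ (ext legal (≤-trans (n≤1+n _) len₁))

      ps₁ : V G → Pos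
      ps₁ u = (u , Inverse.to π u) ∷ ps

      legal₁ : ∀ u → E (ps₁ u)
      legal₁ = proj₂ (ext legal (≤-trans (n≤1+n _) len₁))

      _≈₁[_]_ : V G → V G → V G → Set
      a ≈₁[ u ] b = a ≈[ ps₁ u ] b

      -- With `u` pebbled, `cross` places two more pebbles; this is what the three spare pebbles of
      -- `len` pay for.
      transport₁ : ∀ u {a b} → a ≈₁[ u ] b → Match G G (_≈₁[ u ]_) a b
      transport₁ u = equitable len

      Pure₁-self : ∀ {u} → InS u → Pure (ps₁ u) u
      Pure₁-self i v c = subst InS (sym (≈-pebble c)) i

      Pureᴵ : V G → Set
      Pureᴵ u = ∀ v → v ≈ u → s v ≡ false

      Mixed : V G → Set
      Mixed u = (∃ λ a → a ≈ u × InS a) × (∃ λ b → b ≈ u × s b ≡ false)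

      Mixed-resp : ∀ {u v} → u ≈ v → Mixed u → Mixed v
      Mixed-resp c ((a , ca , ia) , (b , cb , ib)) = (a , ca ◅◅ c , ia) , (b , cb ◅◅ c , ib)

      Mixed⇒¬Pure : ∀ {u} → Mixed u → ¬ Pure ps u
      Mixed⇒¬Pure (_ , b , c , ib) h = true≢false (h b c) ib

      -- The relation `≈` is not known to be decidable, so case distinctions are made under double
      -- negation. The equations of Booleans and of vertices drawn from them are stable.
      classify : ∀ u → ¬ ¬ (Pure ps u ⊎ Pureᴵ u ⊎ Mixed u)
      classify u k = ¬¬-excluded-middle λ
        { (no ¬a) → k (inj₂ (inj₁ λ v c → ≢true⇒≡false λ i → ¬a (v , c , i)))
        ; (yes a) → ¬¬-excluded-middle λ
          { (yes b) → k (inj₂ (inj₂ (a , b)))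
          ; (no ¬b) → k (inj₁ λ v c → bool-stable λ ¬i → ¬b (v , c , ≢true⇒≡false ¬i)) } }

      cover-true : ∀ {u v} → s u ≡ false → adj G u v ≡ true → InS v
      cover-true i a with cover a
      ... | inj₁ j = contradiction i (true≢false j)
      ... | inj₂ j = j

      gain₁ : ∀ u As Ps → length As + length Ps ≡ 3 →
        Apart (ps₁ u) As →
        All (λ a → InS a × ∃ λ b → InS b × b ≈ a × All (λ a′ → ¬ b ≈₁[ u ] a′) As) As →
        Apart (ps₁ u) Ps →
        All (λ a → Pure (ps₁ u) a × (Pure ps a → ∃ λ b → b ≈ a × All (λ a′ → ¬ b ≈₁[ u ] a′) Ps)) Ps →
        ⊥
      gain₁ u As Ps eq x₁ x₂ x₃ x₄ =
        gain ≈-drop scored As Ps x₁ x₂ x₃ x₄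
          λ sc → no-3 (legal₁ u) (subst (λ l → Score (ps₁ u) (l + score)) eq sc)

      -- Pebbling `u` already gains two points: the class {u} enters both lists while a second
      -- vertex of S keeps the old class represented. Separating `a` from `b` would be the third.
      unsplit : ∀ {u p a b} → InS u → InS p → p ≈ u → p ≢ u → InS a → InS b → a ≈ b → a ≢ u → b ≢ u →
        ¬ ¬ a ≈₁[ u ] b
      unsplit {u} {p} {a} {b} iu ip p≈u p≢u ia ib a≈b a≢u b≢u ¬c = ¬¬-excluded-middle λ
        -- The vertex that goes on representing the class of `u` must also avoid the new class of
        -- `a`: `b` does so if `a` lies in the class of `u`, and `p` otherwise.
        { (yes a≈u) → new b ib (≈-sym a≈b ◅◅ a≈u) b≢u (¬c ∘ ≈-sym)
        ; (no a≉u) → new p ip p≈u p≢u λ c → a≉u (≈-sym (≈-drop c) ◅◅ p≈u) }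
        where
        new : ∀ q → InS q → q ≈ u → q ≢ u → ¬ q ≈₁[ u ] a → ⊥
        new q iq q≈u q≢u q≉a = gain₁ u (u ∷ a ∷ []) (u ∷ []) refl
          (((λ c → a≢u (≈-pebble (≈-sym c))) ∷ []) ∷ [] ∷ [])
          ( (iu , q , iq , q≈u , ((λ c → q≢u (≈-pebble c)) ∷ q≉a ∷ []))
          ∷ (ia , b , ib , ≈-sym a≈b , ((λ c → b≢u (≈-pebble c)) ∷ (¬c ∘ ≈-sym) ∷ []))
          ∷ [])
          ([] ∷ [])
          ((Pure₁-self iu , λ _ → p , p≈u , ((λ c → p≢u (≈-pebble c)) ∷ [])) ∷ [])

      -- Two points come from `u` as in `unsplit`; a class that became pure would be the third.
      stays-impure : ∀ {u p a} → InS u → InS p → p ≈ u → p ≢ u → ¬ Pure ps a → a ≢ u → ¬ Pure (ps₁ u) a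
      stays-impure {u} {p} {a} iu ip p≈u p≢u ¬pa a≢u pa = gain₁ u (u ∷ []) (u ∷ a ∷ []) refl
        ([] ∷ [])
        ((iu , p , ip , p≈u , ((λ c → p≢u (≈-pebble c)) ∷ [])) ∷ [])
        (((λ c → a≢u (≈-pebble (≈-sym c))) ∷ []) ∷ [] ∷ [])
        ( (Pure₁-self iu , λ pu → p , p≈u ,
            ((λ c → p≢u (≈-pebble c)) ∷ (λ c → ¬pa (Pure-resp (≈-sym (≈-drop c) ◅◅ p≈u) pu)) ∷ []))
        ∷ (pa , λ pa′ → contradiction pa′ ¬pa)
        ∷ [])

      -- The class {u} is newly pure, which is worth one point, and splitting a pure class adds one
      -- point to each list.
      pure-unsplit : ∀ {u a b} → InS u → ¬ Pure ps u → Pure ps a → a ≈ b → ¬ ¬ a ≈₁[ u ] b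
      pure-unsplit {u} {a} {b} iu ¬pu pa a≈b ¬c = gain₁ u (a ∷ []) (u ∷ a ∷ []) refl
        ([] ∷ [])
        ((pa a ε , b , pa b (≈-sym a≈b) , ≈-sym a≈b , ((¬c ∘ ≈-sym) ∷ [])) ∷ [])
        (((λ c → ¬pu (Pure-resp (≈-drop c) pa)) ∷ []) ∷ [] ∷ [])
        ( (Pure₁-self iu , λ pu → contradiction pu ¬pu)
        ∷ (Pure-drop pa , λ _ → b , ≈-sym a≈b ,
            ((λ c → ¬pu (Pure-resp (≈-sym (≈-drop c) ◅◅ ≈-sym a≈b) pa)) ∷ (¬c ∘ ≈-sym) ∷ []))
        ∷ [])

      -- Homogeneity between classes, and its exceptions over pure classes.

      Row : V G → V G → Set
      Row v x = ∀ y → y ≈ x → y ≢ v → adj G v y ≡ adj G v x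

      -- If the class of `u` has a second vertex, `unsplit` prevents a pebble on `u` from separating
      -- `a` and `b`. If `u` is alone, every transport fixes it, so `a` and `b` see it alike.
      row-pure-pure : ∀ {u a} → Pure ps u → Pure ps a → a ≢ u → Row u a
      row-pure-pure {u} {a} pu pa a≢u b b≈a b≢u = bool-stable λ ne → ¬¬-excluded-middle {A = ∃ λ p → p ≈ u × p ≢ u} λ
        { (yes (p , p≈u , p≢u)) →
            unsplit (pu u ε) (pu p p≈u) p≈u p≢u (pa b b≈a) (pa a ε) b≈a b≢u a≢u λ c → ne (≈-adj c)
        ; (no alone) →
            let M = transport b≈a
                fix = fin-stable λ ≢u → alone (fwd M u , ≈-sym (related M u) , ≢u)
            in ne (trans (adj-sym G u b) (trans (adjacent M u) (trans (cong (adj G a) fix) (adj-sym G a u)))) }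

      -- By `pure-unsplit`, a vertex `t` of S in the mixed class is homogeneous to the pure class; a
      -- transport passes this on to `u`.
      row-mixed-pure : ∀ {u a} → Mixed u → Pure ps a → Row u a
      row-mixed-pure {u} {a} mu@((t , t≈u , it) , _) pa b b≈a b≢u =
        trans (adjacent M b) (trans (const (fwd M b) (≈-sym (related M b) ◅◅ b≈a))
          (trans (sym (const (fwd M a) (≈-sym (related M a)))) (sym (adjacent M a))))
        where
        M = transport (≈-sym t≈u)
        const : ∀ y → y ≈ a → adj G t y ≡ adj G t a
        const y y≈a = bool-stable λ ne →
          pure-unsplit it (Mixed⇒¬Pure (Mixed-resp (≈-sym t≈u) mu)) pa (≈-sym y≈a) λ c → ne (sym (≈-adj c))

      -- A vertex outside S in the class of `x` would, by transport, have a neighbour in the class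
      -- of `v`, and that edge would be uncovered.
      Pureᴵ-neighbour : ∀ {v x} → Pureᴵ v → adj G v x ≡ true → Pure ps x
      Pureᴵ-neighbour {v} {x} pv a y y≈x = bool-stable λ ¬iy →
        let M = transport (≈-sym y≈x) in
        true≢false
          (cover-true (≢true⇒≡false ¬iy) (trans (sym (adjacent M v)) (trans (adj-sym G x v) a)))
          (pv (fwd M v) (≈-sym (related M v)))

      -- Two pebbles on w₁ and w₂ would cut the class of x₁ into four pure classes.
      uncrossed : ∀ {w₁ w₂ x₁ x₂ x₃ x₄} → Pure ps x₁ → x₂ ≈ x₁ → x₃ ≈ x₁ → x₄ ≈ x₁ →
        adj G w₁ x₁ ≡ true → adj G w₂ x₁ ≡ true → adj G w₁ x₂ ≡ true → adj G w₂ x₂ ≡ false →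
        adj G w₁ x₃ ≡ false → adj G w₂ x₃ ≡ true → adj G w₁ x₄ ≡ false → adj G w₂ x₄ ≡ false → ⊥
      uncrossed {w₁} {w₂} {x₁} {x₂} {x₃} {x₄} px c₂ c₃ c₄ a₁ b₁ a₂ b₂ a₃ b₃ a₄ b₄ =
        -- The vertex `x₄` keeps the old class in both lists; the three other classes add three
        -- points to each, six in all.
        gain (λ c → ≈-drop (≈-drop c)) scored L L apart
          (All.map (λ { (ia , b , ca , av) → ia , x₄ , px x₄ c₄ , ca , av }) news)
          apart (All.map (λ { (ia , pa , ca , av) → pa , λ _ → x₄ , ca , av }) news)
          (no-6 e₂)
        where
        q  = ext (legal₁ w₁) len₁
        e₂ = proj₂ q w₂
        ps₂ = (w₂ , Inverse.to (proj₁ q) w₂) ∷ ps₁ w₁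
        L = x₁ ∷ x₂ ∷ x₃ ∷ []
        by₁ : ∀ {x y} → adj G w₁ x ≡ true → adj G w₁ y ≡ false → ¬ x ≈[ ps₂ ] y
        by₁ a b c = true≢false a (trans (≈-adj (≈-drop c)) b)
        by₂ : ∀ {x y} → adj G w₂ x ≡ true → adj G w₂ y ≡ false → ¬ x ≈[ ps₂ ] y
        by₂ a b c = true≢false a (trans (≈-adj c) b)
        apart : Apart ps₂ L
        apart = (by₂ b₁ b₂ ∷ by₁ a₁ a₃ ∷ []) ∷ (by₁ a₂ a₃ ∷ []) ∷ [] ∷ []
        away : All (λ a → ¬ x₄ ≈[ ps₂ ] a) L
        away = (by₁ a₁ a₄ ∘ ≈-sym) ∷ (by₁ a₂ a₄ ∘ ≈-sym) ∷ (by₂ b₃ b₄ ∘ ≈-sym) ∷ []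
        new : ∀ x → x ≈ x₁ → InS x × Pure ps₂ x × x₄ ≈ x × All (λ a → ¬ x₄ ≈[ ps₂ ] a) L
        new x c = px x c , (λ v d → px v (≈-drop (≈-drop d) ◅◅ c)) , c₄ ◅◅ ≈-sym c , away
        news : All (λ x → InS x × Pure ps₂ x × x₄ ≈ x × All (λ a → ¬ x₄ ≈[ ps₂ ] a) L) L
        news = new x₁ ε ∷ new x₂ c₂ ∷ new x₃ c₃ ∷ []

      ≈-decidable : ∀ a → ¬ ¬ (∀ x → Dec (x ≈ a))
      ≈-decidable a = ¬¬-Π-fin λ _ → ¬¬-excluded-middle

      -- Equivalent vertices have equally many neighbours in a class, so no inclusion is proper: the
      -- transport maps N(w₂) injectively into N(w₁), hence into N(w₂), hence onto it, and so
      -- reaches `c`.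
      unnested : ∀ {w₁ w₂ a c} → w₁ ≈ w₂ → (∀ x → x ≈ a → adj G w₁ x ≡ true → adj G w₂ x ≡ true) →
        c ≈ a → adj G w₂ c ≡ true → adj G w₁ c ≡ false → ⊥
      unnested {w₁} {w₂} {a} {c} w₁≈w₂ sub c≈a c₂ c₁ = ≈-decidable a λ dec →
        let M = transport w₁≈w₂
            x , (x≈a , x₂) , eq = injective-on⇒surjective-on
              (λ x → dec x ×-dec (adj G w₂ x Bool.≟ true)) (bwd M)
              (λ { {x} (x≈a , x₂) → related-bwd M x ◅◅ x≈a ,
                     sub _ (related-bwd M x ◅◅ x≈a) (trans (adjacent-bwd M x) x₂) })
              (λ _ _ → bwd-injective M) (c≈a , c₂)
        in true≢false (trans (adjacent-bwd M x) x₂) (trans (cong (adj G w₁) eq) c₁)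

      Sole : Bool → V G → V G → Set
      Sole b v y = adj G v y ≡ b × (∀ y′ → y′ ≈ y → adj G v y′ ≡ b → y′ ≡ y)

      Sole-transport : ∀ {b v v′ y} (M : Match G G _≈_ v v′) → Sole b v y → Sole b v′ (fwd M y)
      Sole-transport {b} M (a , u) = trans (sym (adjacent M _)) a , λ y′ c a′ →
        trans (sym (fwd-bwd M y′)) (cong (fwd M)
          (u (bwd M y′) (related-bwd M y′ ◅◅ c ◅◅ ≈-sym (related M _)) (trans (adjacent-bwd M y′) a′)))

      ¬Sole : ∀ {b v y} → adj G v y ≡ b → ¬ Sole b v y → ¬ ¬ ∃ λ y′ → y′ ≈ y × adj G v y′ ≡ b × y′ ≢ y
      ¬Sole a ¬s k = ¬s (a , λ y′ c a′ → fin-stable λ ne → k (y′ , c , a′ , ne))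

      -- If N(w) contained a second vertex a′ and missed a second vertex b′ of the class, then a′ and b are
      -- alike once a is pebbled, which yields w₂ ≈ w adjacent to both a and b; likewise w₃ ≈ w adjacent to
      -- neither.  As the neighbourhoods do not cross, N(w₃) ⊊ N(w₂) in the class although they have equal size.
      sole : ∀ {w a b} → Pure ps a → b ≈ a → adj G w a ≡ true → adj G w b ≡ false →
        ¬ ¬ (Sole true w a ⊎ Sole false w b)
      sole {w} {a} {b} pa b≈a wa wb k =
        ¬Sole wa (k ∘ inj₁) λ { (a′ , a′≈a , wa′ , a′≢a) →
        ¬Sole wb (k ∘ inj₂) λ { (b′ , b′≈b , wb′ , b′≢b) →
        let ia = pa a ε ; ib = pa b b≈a ; ia′ = pa a′ a′≈a ; ib′ = pa b′ (b′≈b ◅◅ b≈a) in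
        unsplit ia ia′ a′≈a a′≢a ia′ ib (a′≈a ◅◅ ≈-sym b≈a) a′≢a (differ wa wb ∘ sym) λ a′≈₁b →
        unsplit ib ib′ b′≈b b′≢b ib′ ia (b′≈b ◅◅ b≈a) b′≢b (differ wa wb) λ b′≈₁a →
        let M₂ = transport₁ a a′≈₁b ; w₂ = fwd M₂ w ; w≈w₂ = ≈-drop (related M₂ w)
            M₃ = transport₁ b b′≈₁a ; w₃ = fwd M₃ w ; w≈w₃ = ≈-drop (related M₃ w)
            w₂a = trans (flip w₂ a) (trans (sym (≈-adj (related M₂ w))) (trans (flip a w) wa))
            w₂b = trans (flip w₂ b) (trans (sym (adjacent M₂ w)) (trans (flip a′ w) wa′))
            w₃b = trans (flip w₃ b) (trans (sym (≈-adj (related M₃ w))) (trans (flip b w) wb))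
            w₃a = trans (flip w₃ a) (trans (sym (adjacent M₃ w)) (trans (flip b′ w) wb′))
        in
        -- Each failing inclusion yields a vertex: `x` in N(w) but not N(w₂), `y` in N(w₃) but not
        -- N(w), `z` in N(w₃) but not N(w₂). Then N(w) crosses N(w₃) if it contains `z`, and N(w₂)
        -- if it does not.
        unnested w≈w₂ (λ x x≈a wx → bool-stable λ ¬w₂x →
          unnested (≈-sym w≈w₃) (λ y y≈a w₃y → bool-stable λ ¬wy →
            unnested (≈-sym w≈w₃ ◅◅ w≈w₂) (λ z z≈a w₃z → bool-stable λ ¬w₂z →
              ¬¬-excluded-middle {A = adj G w z ≡ true} λ
                { (yes wz) → uncrossed (Pure-resp z≈a pa) (≈-sym z≈a) (y≈a ◅◅ ≈-sym z≈a) (b≈a ◅◅ ≈-sym z≈a)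
                    wz w₃z wa w₃a (≢true⇒≡false ¬wy) w₃y wb w₃b
                ; (no ¬wz) → uncrossed pa x≈a b≈a z≈a
                    wa w₂a wx (≢true⇒≡false ¬w₂x) wb w₂b (≢true⇒≡false ¬wz) (≢true⇒≡false ¬w₂z) })
              ε w₂a w₃a)
            ε wa w₃a)
          b≈a w₂b wb } }
        where
        flip : ∀ x y → adj G x y ≡ adj G y x
        flip = adj-sym G
        differ : ∀ {x y} → adj G w x ≡ true → adj G w y ≡ false → x ≢ y
        differ p q refl = true≢false p q

      row-Pureᴵ : ∀ {v x} → Pureᴵ v → ¬ Pure ps x → Row v x
      row-Pureᴵ {v} {x} pv ¬px y y≈x _ = trans (off y≈x) (sym (off ε))
        where
        off : ∀ {z} → z ≈ x → adj G v z ≡ false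
        off z≈x = ≢true⇒≡false λ a → ¬px (Pure-resp (≈-sym z≈x) (Pureᴵ-neighbour pv a))

      -- Mixed classes: cliques and the matching.

      Complete : V G → Set
      Complete u = ∀ {x y} → x ≈ u → y ≈ u → x ≢ y → adj G x y ≡ true

      Complete-resp : ∀ {u v} → u ≈ v → Complete u → Complete v
      Complete-resp c h x≈v y≈v = h (x≈v ◅◅ ≈-sym c) (y≈v ◅◅ ≈-sym c)

      -- Pebbling u leaves u′ in a mixed class, and the mirror image of the edge u′l joins u to some q ∈ S in the
      -- class of l; so u dominates that class inside S and also reaches l.  A vertex of the class of u outside S
      -- has its neighbours in S only, so equal degrees leave no room unless the class is a clique.
      twin-neighbours : ∀ {l u u′} → s l ≡ false → adj G l u ≡ true → adj G l u′ ≡ true →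
        u′ ≈ u → u′ ≢ u → Mixed u → ¬ ¬ (l ≈ u × Complete u)
      twin-neighbours {l} {u} {u′} il lu lu′ u′≈u u′≢u mu@(_ , w₀ , w₀≈u , iw₀) k =
        ¬¬-excluded-middle {A = ∃ λ w → w ≈₁[ u ] u′ × s w ≡ false} λ
          { (yes (w , w≈₁u′ , iw)) → mirror w w≈₁u′ iw
          ; (no none) → stays-impure iu iu′ u′≈u u′≢u (Mixed⇒¬Pure (Mixed-resp (≈-sym u′≈u) mu)) u′≢u
              (λ v c → bool-stable λ ¬iv → none (v , c , ≢true⇒≡false ¬iv)) }
        where
        iu  = cover-true il lu
        iu′ = cover-true il lu′
        ul : adj G u l ≡ true
        ul = trans (adj-sym G u l) lu

        dominates : ∀ {q} → InS q → l ≈ q → adj G u q ≡ true →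
          ∀ x → x ≈ l → InS x → x ≢ u → adj G u x ≡ true
        dominates {q} iq l≈q uq x x≈l ix x≢u = bool-stable λ ¬ux →
          unsplit iu iu′ u′≈u u′≢u ix iq (x≈l ◅◅ l≈q) x≢u (adj-irrefl-≢ G uq ∘ sym) λ c →
          ¬ux (trans (≈-adj c) uq)

        finish : (∀ x → x ≈ l → InS x → x ≢ u → adj G u x ≡ true) → ⊥
        finish dom = ≈-decidable l λ dec → ¬¬-excluded-middle λ
          -- The neighbours of `u` in the class of `l` include all its vertices in S and `l` too.
          -- Transported to `w₀` outside S they all have to lie in S, which is one too many: the
          -- injection of `A` into itself misses `l`.
          { (no l≉u) →
              let M = transport (≈-sym w₀≈u)
                  A : V G → Set
                  A x = x ≈ l × (InS x ⊎ x ≡ l)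
                  hit : ∀ {x} → A x → InS (fwd M x)
                  hit {x} = λ
                    { (x≈l , inj₁ ix) → cover-true iw₀ (trans (sym (adjacent M x))
                        (dom x x≈l ix λ x≡u → l≉u (subst (l ≈_) x≡u (≈-sym x≈l))))
                    ; (x≈l , inj₂ refl) → cover-true iw₀ (trans (sym (adjacent M x)) ul) }
                  x , Ax , eq = injective-on⇒surjective-on {A = A}
                    (λ x → dec x ×-dec ((s x Bool.≟ true) ⊎-dec (x ≟ l))) (fwd M)
                    (λ { {x} Ax → ≈-sym (related M x) ◅◅ proj₁ Ax , inj₁ (hit Ax) })
                    (λ _ _ → fwd-injective M) (ε , inj₂ refl)
              in true≢false (subst InS eq (hit Ax)) il
          ; (yes l≈u) → k (l≈u , complete dec l≈u) }
          where
          complete : (∀ x → Dec (x ≈ l)) → l ≈ u → Complete u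
          complete dec l≈u {x} {y} x≈u y≈u x≢y =
            let M = transport (≈-sym x≈u) in
            trans (sym (adjacent-bwd M y)) (full (bwd M y) (related-bwd M y ◅◅ y≈u)
              λ eq → x≢y (trans (sym (base M)) (trans (cong (fwd M) (sym eq)) (fwd-bwd M y))))
            where
            A : V G → Set
            A x = x ≈ l × InS x
            joined : ∀ {w p} → w ≈ u → s w ≡ false → p ≈ u → InS p → adj G w p ≡ true
            joined {w} {p} w≈u iw p≈u ip =
              let x , (x≈l , ix) , eq = injective-on⇒surjective-on {A = A} (λ x → dec x ×-dec (s x Bool.≟ true))
                                          g closed inj (p≈u ◅◅ ≈-sym l≈u , ip)
              in trans (cong (adj G w) (sym eq)) (proj₁ (g-spec x≈l ix))
              where
              M = transport (≈-sym w≈u)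
              g : V G → V G
              -- Since `u` is not its own neighbour, its place is taken by `l`, which lies outside S
              -- and hence outside the domain `A`.
              g x with x ≟ u
              ... | yes _ = fwd M l
              ... | no  _ = fwd M x
              g-spec : ∀ {x} → x ≈ l → InS x → adj G w (g x) ≡ true × g x ≈ l
              g-spec {x} x≈l ix with x ≟ u
              ... | yes _ = trans (sym (adjacent M l)) ul , ≈-sym (related M l)
              ... | no x≢u = trans (sym (adjacent M x)) (dom x x≈l ix x≢u) , ≈-sym (related M x) ◅◅ x≈l
              closed : ∀ {x} → A x → A (g x)
              closed (x≈l , ix) = proj₂ (g-spec x≈l ix) , cover-true iw (proj₁ (g-spec x≈l ix))
              inj : ∀ {x y} → A x → A y → g x ≡ g y → x ≡ y
              inj {x} {y} (_ , ix) (_ , iy) eq with x ≟ u | y ≟ u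
              ... | yes p | yes q = trans p (sym q)
              ... | yes p | no  q = contradiction il (true≢false (subst InS (sym (fwd-injective M eq)) iy))
              ... | no  p | yes q = contradiction il (true≢false (subst InS (fwd-injective M eq) ix))
              ... | no  p | no  q = fwd-injective M eq
            full : ∀ y → y ≈ u → y ≢ u → adj G u y ≡ true
            full y y≈u y≢u with s y in iy
            ... | true  = dom y (y≈u ◅◅ ≈-sym l≈u) iy y≢u
            ... | false = trans (adj-sym G u y) (joined y≈u iy ε iu)

        mirror : ∀ w → w ≈₁[ u ] u′ → s w ≡ false → ⊥
        mirror w w≈₁u′ iw =
          let M = transport₁ u (≈-sym w≈₁u′)
              iq = cover-true iw (trans (sym (adjacent M l)) (trans (adj-sym G u′ l) lu′))
          in finish (dominates iq (≈-drop (related M l)) (trans (sym (≈-adj (related M l))) ul))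

      -- The edges of the matching; edges inside a mixed clique do not count.
      Link : V G → V G → Set
      Link x y = Mixed x × Mixed y × adj G x y ≡ true × ¬ (x ≈ y × Complete x)

      Link-sym : ∀ {x y} → Link x y → Link y x
      Link-sym (mx , my , a , n) =
        my , mx , trans (adj-sym G _ _) a , λ { (y≈x , c) → n (≈-sym y≈x , Complete-resp y≈x c) }

      Link-transport : ∀ {x x′ y} → x ≈ x′ → (M : Match G G _≈_ x x′) → Link x y → Link x′ (fwd M y)
      Link-transport c M (mx , my , a , n) =
        Mixed-resp c mx , Mixed-resp (related M _) my , trans (sym (adjacent M _)) a ,
        λ { (d , h) → n (c ◅◅ d ◅◅ ≈-sym (related M _) , Complete-resp (≈-sym c) h) }

      -- Move `x` to a vertex `l` of its class outside S. Two partners in one class would be twin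
      -- neighbours of `l`, which makes that class a clique containing `x`, against `Link`.
      Link-sole : ∀ {x y} → Link x y → Sole true x y
      Link-sole {x} {y} lk@((_ , (l , l≈x , il)) , my , a , n) = a , λ y′ y′≈y a′ → fin-stable λ y′≢y →
        let M = transport (≈-sym l≈x)
            y′≈y′ = ≈-sym (related M y′) ◅◅ y′≈y ◅◅ related M y
        in twin-neighbours il (trans (sym (adjacent M y)) a) (trans (sym (adjacent M y′)) a′)
             y′≈y′ (y′≢y ∘ fwd-injective M) (Mixed-resp (related M y) my)
             λ { (l≈y , c) → n ( ≈-sym l≈x ◅◅ l≈y ◅◅ ≈-sym (related M y)
                               , Complete-resp (≈-sym l≈y ◅◅ l≈x) c) }

      -- Suppose the partners lie in two classes. A pebble on a vertex `w` outside S in the class of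
      -- `x` makes the new class of each partner pure, which gains two points. The third comes from
      -- a second vertex of S in a partner's class or, failing that, from the rest of the class of
      -- `w`, which becomes pure.
      Link-unique : ∀ {x y₁ y₂} → Link x y₁ → Link x y₂ → y₁ ≡ y₂
      Link-unique {x} {y₁} {y₂} k₁@((_ , (w , w≈x , iw)) , _) k₂ = fin-stable λ y₁≢y₂ →
        ¬¬-excluded-middle {A = y₁ ≈ y₂} λ
        { (yes c) → y₁≢y₂ (proj₂ (Link-sole k₂) y₁ c (proj₁ (Link-sole k₁)))
        ; (no ¬c) → independent (Link-transport (≈-sym w≈x) M k₁) (Link-transport (≈-sym w≈x) M k₂)
            λ c → ¬c (related M y₁ ◅◅ c ◅◅ ≈-sym (related M y₂)) }
        where
        M = transport (≈-sym w≈x)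

        Alone : V G → Set
        Alone q = ∀ x → x ≈ q → InS x → x ≡ q

        independent : ∀ {q₁ q₂} → Link w q₁ → Link w q₂ → ¬ q₁ ≈ q₂ → ⊥
        independent {q₁} {q₂} k₁@(((u , u≈w , iu) , _) , m₁ , a₁ , _) k₂@(_ , m₂ , a₂ , _) q₁≉q₂ =
          not-alone k₁ (λ al₁ → not-alone k₂ (λ al₂ → stuck al₁ al₂))
          where
          purified : ∀ {q} → Link w q → Pure (ps₁ w) q
          purified (_ , _ , a , _) v c = cover-true iw (trans (≈-adj c) a)
          new : ∀ {q Ps} → Link w q →
            Pure (ps₁ w) q × (Pure ps q → ∃ λ b → b ≈ q × All (λ a′ → ¬ b ≈₁[ w ] a′) Ps)
          new k@(_ , m , _) = purified k , λ p → contradiction p (Mixed⇒¬Pure m)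

          not-alone : ∀ {q} → Link w q → (Alone q → ⊥) → ⊥
          not-alone {q} k@(_ , m , a , _) h = h λ x x≈q ix → fin-stable λ x≢q →
            gain₁ w (q ∷ []) (q₁ ∷ q₂ ∷ []) refl
              ([] ∷ [])
              (( cover-true iw a , x , ix , x≈q
               , ((λ c → x≢q (proj₂ (Link-sole k) x x≈q (trans (≈-adj c) a))) ∷ [])) ∷ [])
              (((λ c → q₁≉q₂ (≈-drop c)) ∷ []) ∷ [] ∷ [])
              (new k₁ ∷ new k₂ ∷ [])

          stuck : Alone q₁ → Alone q₂ → ⊥
          stuck al₁ al₂ = gain₁ w [] (q₁ ∷ q₂ ∷ u ∷ []) refl [] []
            (((λ c → q₁≉q₂ (≈-drop c)) ∷ (λ c → far k₁ al₁ (≈-drop c ◅◅ u≈w)) ∷ [])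
              ∷ ((λ c → far k₂ al₂ (≈-drop c ◅◅ u≈w)) ∷ []) ∷ [] ∷ [])
            ( new k₁ ∷ new k₂
            ∷ (pure-u , λ p → contradiction p (Mixed⇒¬Pure (Mixed-resp (≈-sym u≈w) (proj₁ k₁))))
            ∷ [])
            where
            -- The transport from `w` to `v` takes `q₁` to a neighbour of `v`, hence into S, hence
            -- to `q₁` itself; and `w` is the only neighbour of `q₁` in this class.
            only-w : ∀ v → v ≈ w → s v ≡ false → v ≡ w
            only-w v v≈w iv =
              let N = transport (≈-sym v≈w)
                  vt = trans (sym (adjacent N q₁)) a₁
                  eq = al₁ (fwd N q₁) (≈-sym (related N q₁)) (cover-true iv vt)
              in proj₂ (Link-sole (Link-sym k₁)) v v≈w
                   (trans (adj-sym G q₁ v) (trans (cong (adj G v) (sym eq)) vt))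
            pure-u : Pure (ps₁ w) u
            pure-u v c = bool-stable λ ¬iv →
              let v≡w = only-w v (≈-drop c ◅◅ u≈w) (≢true⇒≡false ¬iv)
                  u≡w = ≈-pebble (≈-sym (subst (_≈₁[ w ] u) v≡w c))
              in true≢false iu (subst (λ x → s x ≡ false) (sym u≡w) iw)
            -- Otherwise the class of `w` would consist of `q` and `w` alone and be a clique, which
            -- `Link` excludes.
            far : ∀ {q} → Link w q → Alone q → ¬ q ≈ w
            far {q} (_ , _ , a , n) al q≈w = n (≈-sym q≈w , complete)
              where
              member : ∀ x → x ≈ w → x ≡ q ⊎ x ≡ w
              member x x≈w with s x in ix
              ... | true  = inj₁ (al x (x≈w ◅◅ ≈-sym q≈w) ix)
              ... | false = inj₂ (only-w x x≈w ix)
              complete : Complete w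
              complete {x} {y} x≈w y≈w x≢y with member x x≈w | member y y≈w
              ... | inj₁ refl | inj₁ refl = contradiction refl x≢y
              ... | inj₁ refl | inj₂ refl = trans (adj-sym G q w) a
              ... | inj₂ refl | inj₁ refl = a
              ... | inj₂ refl | inj₂ refl = contradiction refl x≢y

      -- Class-respecting maps that preserve the matching.

      infix 4 _⋈_
      _⋈_ : V G → V H → Set
      u ⋈ w = u ⋈[ ps ] w

      -- Under the equitable bijection from `v` to `z`, both `z₁` and `z₂` pull back to `y`.
      sole-image : ∀ {b v y z z₁ z₂} → Sole b v y → v ⋈ z → y ⋈ z₁ → y ⋈ z₂ →
        adj H z z₁ ≡ b → adj H z z₂ ≡ b → z₁ ≡ z₂
      sole-image {y = y} (_ , uniq) v⋈z y⋈z₁ y⋈z₂ a₁ a₂ = bwd-injective M (trans (at y⋈z₁ a₁) (sym (at y⋈z₂ a₂)))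
        where
        M = ⋈-equitable len₁ v⋈z
        at : ∀ {z′} → y ⋈ z′ → adj H _ z′ ≡ _ → bwd M z′ ≡ y
        at {z′} c a = uniq (bwd M z′) (⋈-join (related-bwd M z′) c) (trans (adjacent-bwd M z′) a)

      record ClassMap : Set where
        field
          map : V G → V H
          map-injective : Injective _≡_ _≡_ map
          map-⋈ : ∀ v → v ⋈ map v

      open ClassMap

      Preserves : ClassMap → V G → Set
      Preserves f u = ∀ y → Link u y → adj H (map f u) (map f y) ≡ true

      module _ (f : ClassMap) {u y : V G} (lk : Link u y)
               {z : V H} (y⋈z : y ⋈ z) (fu-z : adj H (map f u) z ≡ true) where

        private
          -- If `x` had the value of `y`, then x = y and x′ = u, so that value would already be `z`.
          -- If `x` had the value `z`, then `x′` would lie in the class of `u` and both their values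
          -- would be the partner of `z`, so x′ = u and again x = y.
          safe : map f y ≢ z → ∀ {x x′} → Link x x′ → adj H (map f x) (map f x′) ≡ true →
            map f x ≢ z × map f x ≢ map f y
          safe fy≢z {x} {x′} kx a = not-z , not-fy
            where
            not-fy : map f x ≢ map f y
            not-fy eq = fy≢z (sole-image (Link-sole lk) (map-⋈ f u) (map-⋈ f y) y⋈z fu-fy fu-z)
              where
              x≡y : x ≡ y
              x≡y = map-injective f eq
              x′≡u : x′ ≡ u
              x′≡u = Link-unique (subst (λ t → Link t x′) x≡y kx) (Link-sym lk)
              fu-fy : adj H (map f u) (map f y) ≡ true
              fu-fy = trans (adj-sym H _ _)
                (trans (sym (cong₂ (λ p q → adj H (map f p) (map f q)) x≡y x′≡u)) a)
            not-z : map f x ≢ z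
            not-z eq = not-fy (cong (map f) (Link-unique (Link-sym (subst (Link x) x′≡u kx)) lk))
              where
              x⋈z = subst (x ⋈_) eq (map-⋈ f x)
              x≈y = ⋈-join x⋈z y⋈z
              M′ = transport (≈-sym x≈y)
              u≈x′ : u ≈ x′
              u≈x′ = subst (u ≈_) (Link-unique (Link-transport (≈-sym x≈y) M′ (Link-sym lk)) kx) (related M′ u)
              x′≡u : x′ ≡ u
              x′≡u = map-injective f (sole-image (Link-sole kx) x⋈z (map-⋈ f x′) (≈-⋈ (≈-sym u≈x′) (map-⋈ f u))
                (subst (λ t → adj H t (map f x′) ≡ true) eq a) (trans (adj-sym H z _) fu-z))

        -- Exchanging the values z and f y repairs the link u–y and spoils no link that is already preserved.
        repair : Σ ClassMap λ f′ → Preserves f′ u × (∀ x → Preserves f x → Preserves f′ x)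
        repair with map f y ≟ z
        ... | yes eq = f , (λ y′ k → subst (λ t → adj H (map f u) (map f t) ≡ true) (Link-unique lk k)
                               (trans (cong (adj H (map f u)) eq) fu-z)) , λ _ h → h
        ... | no fy≢z = f′ , good , keep
          where
          t : V H → V H
          t = transpose z (map f y)
          rel : ∀ v → v ⋈ t (map f v)
          rel v with transpose-cases z (map f y) (map f v)
          ... | inj₁ (p , q) = subst (v ⋈_) (sym q) (≈-⋈ (⋈-join (subst (v ⋈_) p (map-⋈ f v)) y⋈z) (map-⋈ f y))
          ... | inj₂ (inj₁ (p , q)) = subst (v ⋈_) (sym q) (subst (_⋈ z) (sym (map-injective f p)) y⋈z)
          ... | inj₂ (inj₂ (_ , _ , q)) = subst (v ⋈_) (sym q) (map-⋈ f v)
          f′ : ClassMap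
          f′ = record
            { map = λ v → t (map f v)
            ; map-injective = λ eq → map-injective f (transpose-injective _ _ eq)
            ; map-⋈ = rel }
          fixed : ∀ {x} → map f x ≢ z × map f x ≢ map f y → t (map f x) ≡ map f x
          fixed {x} (n₁ , n₂) with transpose-cases z (map f y) (map f x)
          ... | inj₁ (p , _) = contradiction p n₁
          ... | inj₂ (inj₁ (p , _)) = contradiction p n₂
          ... | inj₂ (inj₂ (_ , _ , q)) = q
          t-fy : t (map f y) ≡ z
          t-fy with transpose-cases z (map f y) (map f y)
          ... | inj₁ (p , _) = contradiction p fy≢z
          ... | inj₂ (inj₁ (_ , q)) = q
          ... | inj₂ (inj₂ (_ , n , _)) = contradiction refl n
          good : Preserves f′ u
          good y′ k = subst (λ t′ → adj H (t (map f u)) (t (map f t′)) ≡ true) (Link-unique lk k)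
            (trans (cong₂ (adj H) (fixed (adj-irrefl-≢ H fu-z ,
              λ eq → adj-irrefl-≢ G (proj₁ (Link-sole lk)) (map-injective f eq))) t-fy) fu-z)
          keep : ∀ x → Preserves f x → Preserves f′ x
          keep x h x′ k = trans (cong₂ (adj H) (fixed (safe fy≢z k (h x′ k)))
            (fixed (safe fy≢z (Link-sym k) (trans (adj-sym H _ _) (h x′ k))))) (h x′ k)

      -- Start from `π` and repair the vertices one by one; the target `z` for the partner of `u` is
      -- supplied by the equitable bijection at `u`.
      link-map : ¬ ¬ Σ ClassMap λ f → ∀ u → Preserves f u
      link-map k = go (allFin _) λ { (f , good) → k (f , λ u → All.lookup good (∈-allFin u)) }
        where
        go : ∀ us → ¬ ¬ Σ ClassMap λ f → All (Preserves f) us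
        go [] k = k (record
          { map = Inverse.to π
          ; map-injective = λ {x} {y} eq → trans (sym (Inverse.strictlyInverseʳ π x))
              (trans (cong (Inverse.from π) eq) (Inverse.strictlyInverseʳ π y))
          ; map-⋈ = λ v → v , ε , legal₁ v } , [])
        go (u ∷ us) k = go us λ { (f , good) → ¬¬-excluded-middle {A = ∃ λ y → Link u y} λ
          { (no none) → k (f , (λ y l → contradiction (y , l) none) ∷ good)
          ; (yes (y , l)) →
              let M = ⋈-equitable len₁ (map-⋈ f u)
                  f′ , new , old = repair f l (related M y) (trans (sym (adjacent M y)) (proj₁ (Link-sole l)))
              in k (f′ , new ∷ All.map (old _) good) } }

      -- Leaves, co-leaves and the isomorphism.

      Leaf : Bool → V G → V G → Set
      Leaf b v p = Pureᴵ v × Pure ps p × Sole b v p × ∃ λ p′ → p′ ≈ p × p′ ≢ p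

      Leaf-transport : ∀ {b v v′ p} → v ≈ v′ → Leaf b v p → ∃ λ p′ → Leaf b v′ p′
      Leaf-transport {p = p} c (pv , pp , so , p′ , p′≈p , ne) = fwd M p ,
        (λ x d → pv x (d ◅◅ ≈-sym c)) , Pure-resp (≈-sym (related M p)) pp , Sole-transport M so ,
        fwd M p′ , ≈-sym (related M p′) ◅◅ p′≈p ◅◅ related M p , λ eq → ne (fwd-injective M eq)
        where M = transport c

      -- A pebble on `v` would split two pure classes, each worth two points; three of these four
      -- points suffice.
      Leaf-class : ∀ {b b′ v p p′} → Leaf b v p → Leaf b′ v p′ → ¬ ¬ p ≈ p′
      Leaf-class {v = v} {p} {p′} (_ , pp , (a , uniq) , q , q≈p , q≢p) (_ , pp′ , (a′ , uniq′) , q′ , q′≈p′ , q′≢p′) p≉p′ =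
        gain₁ v (p ∷ []) (p ∷ p′ ∷ []) refl
          ([] ∷ []) ((pp p ε , q , pp q q≈p , q≈p , (q≉p ∷ [])) ∷ [])
          (((λ c → p≉p′ (≈-drop c)) ∷ []) ∷ [] ∷ [])
          ( (Pure-drop pp , λ _ → q , q≈p , (q≉p ∷ (λ c → p≉p′ (≈-sym q≈p ◅◅ ≈-drop c)) ∷ []))
          ∷ (Pure-drop pp′ , λ _ → q′ , q′≈p′ ,
              ( (λ c → p≉p′ (≈-sym (≈-drop c) ◅◅ q′≈p′))
              ∷ (λ c → q′≢p′ (uniq′ q′ q′≈p′ (trans (≈-adj c) a′))) ∷ []))
          ∷ [])
        where
        q≉p : ¬ q ≈₁[ v ] p
        q≉p c = q≢p (uniq q q≈p (trans (≈-adj c) a))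

      nonuniform⇒Leaf : ∀ {v x y} → Pureᴵ v → Pure ps x → y ≈ x → adj G v y ≢ adj G v x →
        ¬ ¬ ∃ λ b → ∃ λ q → q ≈ x × Leaf b v q
      nonuniform⇒Leaf {v} {x} {y} pv px y≈x ne k with adj G v x in vx | adj G v y in vy
      ... | true  | true  = ne refl
      ... | false | false = ne refl
      ... | true  | false = sole px y≈x vx vy λ
        { (inj₁ so) → k (true , x , ε , pv , px , so , y , y≈x , y≢x)
        ; (inj₂ so) → k (false , y , y≈x , pv , Pure-resp y≈x px , so , x , ≈-sym y≈x , y≢x ∘ sym) }
        where
        y≢x : y ≢ x
        y≢x refl = true≢false vx vy
      ... | false | true  = sole (Pure-resp y≈x px) (≈-sym y≈x) vy vx λ
        { (inj₁ so) → k (true , y , y≈x , pv , Pure-resp y≈x px , so , x , ≈-sym y≈x , y≢x ∘ sym)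
        ; (inj₂ so) → k (false , x , ε , pv , px , so , y , y≈x , y≢x) }
        where
        y≢x : y ≢ x
        y≢x refl = true≢false vy vx

      -- Over a class of two vertices a leaf is both of kind true and of kind false; true takes precedence.
      LeafKind : V G → Set
      LeafKind v = (∃ λ p → Leaf true v p)
                 ⊎ ((¬ ∃ λ p → Leaf true v p) × ∃ λ p → Leaf false v p)
                 ⊎ (∀ b → ¬ ∃ λ p → Leaf b v p)

      leaf-kind : ∀ v → ¬ ¬ LeafKind v
      leaf-kind v k = ¬¬-excluded-middle {A = ∃ λ p → Leaf true v p} λ
        { (yes l) → k (inj₁ l)
        ; (no ¬l) → ¬¬-excluded-middle {A = ∃ λ p → Leaf false v p} λ
          { (yes l) → k (inj₂ (inj₁ (¬l , l)))
          ; (no ¬m) → k (inj₂ (inj₂ λ { true → ¬l ; false → ¬m })) } }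

      module Isomorphism (f₀ : ClassMap) (links : ∀ u → Preserves f₀ u) (kind : ∀ v → LeafKind v) where

        around : ∀ p → Match G H _⋈_ p (map f₀ p)
        around p = ⋈-equitable len₁ (map-⋈ f₀ p)

        -- All leaves at `p` are placed by the same equitable bijection from `p` to its image, so
        -- they become distinct leaves at that image.
        image : ∀ v → LeafKind v → V H
        image v (inj₁ (p , _))            = fwd (around p) v
        image v (inj₂ (inj₁ (_ , p , _))) = fwd (around p) v
        image v (inj₂ (inj₂ _))           = map f₀ v

        f : V G → V H
        f v = image v (kind v)

        LeafView : V G → V H → Set
        LeafView v w = ∃ λ b → ∃ λ p → Leaf b v p × w ≡ fwd (around p) v × (b ≡ false → ¬ ∃ λ p → Leaf true v p)

        view : ∀ v → LeafView v (f v) ⊎ (f v ≡ map f₀ v × ∀ b → ¬ ∃ λ p → Leaf b v p)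
        view v with kind v
        ... | inj₁ (p , l)             = inj₁ (true , p , l , refl , λ ())
        ... | inj₂ (inj₁ (¬l , p , l)) = inj₁ (false , p , l , refl , λ _ → ¬l)
        ... | inj₂ (inj₂ ¬l)           = inj₂ (refl , ¬l)

        f-⋈ : ∀ v → v ⋈ f v
        f-⋈ v with view v
        ... | inj₁ (_ , p , _ , eq , _) = subst (v ⋈_) (sym eq) (related (around p) v)
        ... | inj₂ (eq , _)             = subst (v ⋈_) (sym eq) (map-⋈ f₀ v)

        f-stable : ∀ {v} → ¬ Pureᴵ v → f v ≡ map f₀ v
        f-stable {v} ¬p with view v
        ... | inj₁ (_ , _ , (p , _) , _) = contradiction p ¬p
        ... | inj₂ (eq , _)              = eq

        Pure⇒¬Pureᴵ : ∀ {v} → Pure ps v → ¬ Pureᴵ v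
        Pure⇒¬Pureᴵ p q = true≢false (p _ ε) (q _ ε)

        Mixed⇒¬Pureᴵ : ∀ {v} → Mixed v → ¬ Pureᴵ v
        Mixed⇒¬Pureᴵ ((a , c , i) , _) q = true≢false i (q a c)

        around-adj : ∀ {b v p} → Leaf b v p → adj H (fwd (around p) v) (map f₀ p) ≡ b
        around-adj {p = p} (_ , _ , (a , _) , _) =
          trans (adj-sym H _ _) (trans (sym (adjacent (around p) _)) (trans (adj-sym G p _) a))

        -- Equivalent vertices are both leaves or both not, and of the same kind by precedence. For
        -- two leaves with one image the centres share a class, and the image has only one centre
        -- there; so the centres agree, and the bijection around it is injective.
        f-injective : Injective _≡_ _≡_ f
        f-injective {v} {v′} eq with ⋈-join (subst (v ⋈_) eq (f-⋈ v)) (f-⋈ v′)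
        ... | v≈v′ with view v | view v′
        ... | inj₂ (e , _)             | inj₂ (e′ , _) = map-injective f₀ (trans (sym e) (trans eq e′))
        ... | inj₁ (_ , p , l , _)     | inj₂ (_ , ¬l) = contradiction (Leaf-transport v≈v′ l) (¬l _)
        ... | inj₂ (_ , ¬l)            | inj₁ (_ , p , l , _) = contradiction (Leaf-transport (≈-sym v≈v′) l) (¬l _)
        ... | inj₁ (b , p , l , e , n) | inj₁ (b′ , p′ , l′ , e′ , n′) = same (bool-ext b⇒b′ b′⇒b)
          where
          b⇒b′ : b ≡ true → b′ ≡ true
          b⇒b′ refl = bool-stable λ ne → n′ (≢true⇒≡false ne) (Leaf-transport v≈v′ l)
          b′⇒b : b′ ≡ true → b ≡ true
          b′⇒b refl = bool-stable λ ne → n (≢true⇒≡false ne) (Leaf-transport (≈-sym v≈v′) l′)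
          same : b ≡ b′ → v ≡ v′
          same refl = fin-stable λ v≢v′ →
            Leaf-class (proj₂ (Leaf-transport v≈v′ l)) l′ λ c →
            centre v≢v′ (related (transport v≈v′) p ◅◅ c)
            where
            centre : v ≢ v′ → p ≈ p′ → ⊥
            centre v≢v′ p≈p′ with map-injective f₀ (sole-image (proj₁ (proj₂ (proj₂ l)))
                 (subst (v ⋈_) e (f-⋈ v)) (map-⋈ f₀ p) (≈-⋈ p≈p′ (map-⋈ f₀ p′))
                 (around-adj l) (trans (cong (λ t → adj H t (map f₀ p′)) (trans (sym e) (trans eq e′))) (around-adj l′)))
            ... | refl = v≢v′ (fwd-injective (around p) (trans (sym e) (trans eq e′)))

        -- Pulling `f x` back along the equitable bijection from `v` to `f v` gives a vertex of the
        -- class of `x` other than `v`, to which homogeneity applies.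
        row-adj : ∀ {v x} → v ≢ x → Row v x → adj G v x ≡ adj H (f v) (f x)
        row-adj {v} {x} v≢x row = sym (trans (sym (adjacent-bwd M (f x)))
            (row (bwd M (f x)) (⋈-join (related-bwd M (f x)) (f-⋈ x))
              λ eq → v≢x (f-injective (trans (sym (base M)) (trans (cong (fwd M) (sym eq)) (fwd-bwd M (f x)))))))
          where M = ⋈-equitable len₁ (f-⋈ v)

        -- Once the pair at the sole vertex is right, all other vertices of the class take the
        -- opposite value on both sides.
        sole-adj : ∀ {b v x y} → Sole b v y → x ≈ y → adj H (f v) (f y) ≡ b → adj G v x ≡ adj H (f v) (f x)
        sole-adj {b} {v} {x} {y} so@(a , uniq) x≈y a′ with x ≟ y
        ... | yes refl = trans a (sym a′)
        ... | no x≢y = trans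
          (Bool.¬-not λ e → x≢y (uniq x x≈y e))
          (sym (Bool.¬-not λ e → x≢y (f-injective
            (sole-image so (f-⋈ v) (≈-⋈ (≈-sym x≈y) (f-⋈ x)) (f-⋈ y) e a′))))

        leaf-adj : ∀ {v x} → Pureᴵ v → Pure ps x → v ≢ x → adj G v x ≡ adj H (f v) (f x)
        leaf-adj {v} {x} pv px v≢x = bool-stable λ ne → ¬¬-excluded-middle λ
          { (yes row) → ne (row-adj v≢x row)
          ; (no ¬row) → ¬row λ y y≈x _ → bool-stable λ ne′ →
              nonuniform⇒Leaf pv px y≈x ne′ λ { (b , q , q≈x , l) → at-leaf ne q≈x l } }
          where
          at-leaf : adj G v x ≢ adj H (f v) (f x) → ∀ {b q} → q ≈ x → Leaf b v q → ⊥
          at-leaf ne {b} {q} q≈x l with view v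
          ... | inj₂ (_ , ¬l) = ¬l b (q , l)
          ... | inj₁ (_ , p , l′@(_ , pp , so , _) , e , _) = Leaf-class l l′ λ q≈p →
            ne (sole-adj so (≈-sym q≈x ◅◅ q≈p)
              (trans (cong₂ (adj H) e (f-stable (Pure⇒¬Pureᴵ pp))) (around-adj l′)))

        -- Without a link, an edge from `v` into the class of `x` can only be inside a mixed clique,
        -- so `v` is homogeneous to that class.
        mixed-adj : ∀ {v x} → Mixed v → Mixed x → v ≢ x → adj G v x ≡ adj H (f v) (f x)
        mixed-adj {v} {x} mv mx v≢x = bool-stable λ ne → ¬¬-excluded-middle {A = ∃ λ y → y ≈ x × Link v y} λ
          { (yes (y , y≈x , l)) → ne (sole-adj (Link-sole l) (≈-sym y≈x)
              (trans (cong₂ (adj H) (f-stable (Mixed⇒¬Pureᴵ mv))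
                                    (f-stable (Mixed⇒¬Pureᴵ (Mixed-resp (≈-sym y≈x) mx))))
                (links v y l)))
          ; (no none) → ne (row-adj v≢x (row none)) }
          where
          row : (¬ ∃ λ y → y ≈ x × Link v y) → Row v x
          row none y y≈x y≢v = bool-ext
            (λ a → all y≈x a (v≢x ∘ sym) ε)
            (λ a → all ε a y≢v y≈x)
            where
            all : ∀ {z z′} → z ≈ x → adj G v z ≡ true → z′ ≢ v → z′ ≈ x → adj G v z′ ≡ true
            all {z} {z′} z≈x a z′≢v z′≈x = bool-stable λ ne →
              none (z , z≈x , mv , Mixed-resp (≈-sym z≈x) mx , a , λ { (v≈z , c) →
                ne (c ε (z′≈x ◅◅ ≈-sym z≈x ◅◅ ≈-sym v≈z) (z′≢v ∘ sym)) })

        f-adj : ∀ v x → adj G v x ≡ adj H (f v) (f x)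
        f-adj v x with v ≟ x
        ... | yes refl = trans (adj-irr G v) (sym (adj-irr H (f v)))
        ... | no v≢x = bool-stable λ ne → classify v λ cv → classify x λ cx → ne (cases cv cx)
          where
          x≢v : x ≢ v
          x≢v = v≢x ∘ sym
          flip : adj G x v ≡ adj H (f x) (f v) → adj G v x ≡ adj H (f v) (f x)
          flip eq = trans (adj-sym G v x) (trans eq (adj-sym H (f x) (f v)))
          Class : V G → Set
          Class u = Pure ps u ⊎ Pureᴵ u ⊎ Mixed u
          cases : Class v → Class x → adj G v x ≡ adj H (f v) (f x)
          cases (inj₁ pv)        (inj₁ px)        = row-adj v≢x (row-pure-pure pv px x≢v)
          cases (inj₁ pv)        (inj₂ (inj₁ ix)) = flip (leaf-adj ix pv x≢v)
          cases (inj₁ pv)        (inj₂ (inj₂ mx)) = flip (row-adj x≢v (row-mixed-pure mx pv))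
          cases (inj₂ (inj₁ iv)) (inj₁ px)        = leaf-adj iv px v≢x
          cases (inj₂ (inj₁ iv)) (inj₂ (inj₁ ix)) = row-adj v≢x (row-Pureᴵ iv λ px → Pure⇒¬Pureᴵ px ix)
          cases (inj₂ (inj₁ iv)) (inj₂ (inj₂ mx)) = row-adj v≢x (row-Pureᴵ iv (Mixed⇒¬Pure mx))
          cases (inj₂ (inj₂ mv)) (inj₁ px)        = row-adj v≢x (row-mixed-pure mv px)
          cases (inj₂ (inj₂ mv)) (inj₂ (inj₁ ix)) = flip (row-adj x≢v (row-Pureᴵ ix (Mixed⇒¬Pure mv)))
          cases (inj₂ (inj₂ mv)) (inj₂ (inj₂ mx)) = mixed-adj mv mx v≢x

        isomorphism : Iso G H
        isomorphism = mk↔ₛ′ f (λ z → proj₁ (pre z)) (λ z → proj₂ (pre z)) (λ v → f-injective (proj₂ (pre (f v)))) , f-adj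
          where
          from-π-injective : Injective _≡_ _≡_ (Inverse.from π)
          from-π-injective {x} {y} eq = trans (sym (Inverse.strictlyInverseˡ π x))
            (trans (cong (Inverse.to π) eq) (Inverse.strictlyInverseˡ π y))
          pre : ∀ z → ∃ λ v → f v ≡ z
          pre z with injective⇒surjective (Inverse.from π ∘ f) (f-injective ∘ from-π-injective) (Inverse.from π z)
          ... | v , eq = v , from-π-injective eq

      isomorphic : ¬ ¬ Iso G H
      isomorphic k = link-map λ { (f₀ , links) → ¬¬-Π-fin leaf-kind λ kind →
        k (Isomorphism.isomorphism f₀ links kind) }

    isomorphic : E [] → (∀ l → 3 * l ≤ r + r → 3 + l ≤ k) → ¬ ¬ Iso G H
    isomorphic e₀ le no-iso = saturate e₀ λ { (ps , sat) →
      Structure.isomorphic sat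
        (le (length ps) (≤-trans (Saturated.short sat) (Score-bound (Saturated.scored sat))))
        no-iso }

-- Finite types and search for bijections.

to-injective : {A B : Set} (π : A ↔ B) → ∀ {x y} → to π x ≡ to π y → x ≡ y
to-injective π {x} {y} eq = trans (sym (strictlyInverseʳ π x)) (trans (cong (from π) eq) (strictlyInverseʳ π y))

Exhaustible : Set → Set₁
Exhaustible A = {P : A → Set} → (∀ a → Dec (P a)) → Dec (∃ P)

bool-exhaustible : Exhaustible Bool
bool-exhaustible P? = map′
  (λ { (inj₁ p) → true , p ; (inj₂ p) → false , p })
  (λ { (true , p) → inj₁ p ; (false , p) → inj₂ p })
  (P? true ⊎-dec P? false)

vec-exhaustible : {A : Set} → Exhaustible A → ∀ n → Exhaustible (Vec A n)
vec-exhaustible ex zero P? = map′ ([] ,_) (λ { ([] , p) → p }) (P? [])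
vec-exhaustible ex (suc n) P? = map′
  (λ { (x , xs , p) → x ∷ xs , p }) (λ { (x ∷ xs , p) → x , xs , p })
  (ex λ x → vec-exhaustible ex n λ xs → P? (x ∷ xs))

Finite : Set → Set
Finite A = ∃ λ n → A ↔ Fin n

fin-finite : ∀ {n} → Finite (Fin n)
fin-finite = _ , mk↔ₛ′ (λ i → i) (λ i → i) (λ _ → refl) (λ _ → refl)

subtype-≡ : {A : Set} (p : A → Bool) {x y : Σ A (T ∘ p)} → proj₁ x ≡ proj₁ y → x ≡ y
subtype-≡ p {a , t} {.a , t′} refl = cong (a ,_) (Bool.T-irrelevant t t′)

subtype-finite : ∀ {n} (p : Fin n → Bool) → Finite (Σ (Fin n) (T ∘ p))
subtype-finite {zero} p = 0 , mk↔ₛ′ (λ ()) (λ ()) (λ ()) (λ ())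
subtype-finite {suc n} p with p zero in eq | subtype-finite (p ∘ suc)
... | true | m , π = suc m , mk↔ₛ′ fw bw fb bf
  where
  fw : Σ (Fin (suc n)) (T ∘ p) → Fin (suc m)
  fw (zero , _)  = zero
  fw (suc i , t) = suc (to π (i , t))
  bw : Fin (suc m) → Σ (Fin (suc n)) (T ∘ p)
  bw zero    = zero , subst T (sym eq) tt
  bw (suc j) = suc (proj₁ (from π j)) , proj₂ (from π j)
  fb : ∀ j → fw (bw j) ≡ j
  fb zero    = refl
  fb (suc j) = cong suc (strictlyInverseˡ π j)
  bf : ∀ x → bw (fw x) ≡ x
  bf (zero , t)  = subtype-≡ p refl
  bf (suc i , t) = subtype-≡ p (cong (suc ∘ proj₁) (strictlyInverseʳ π (i , t)))
... | false | m , π = m , mk↔ₛ′ fw bw (strictlyInverseˡ π) bf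
  where
  fw : Σ (Fin (suc n)) (T ∘ p) → Fin m
  fw (zero , t)  = ⊥-elim (subst T eq t)
  fw (suc i , t) = to π (i , t)
  bw : Fin m → Σ (Fin (suc n)) (T ∘ p)
  bw j = suc (proj₁ (from π j)) , proj₂ (from π j)
  bf : ∀ x → bw (fw x) ≡ x
  bf (zero , t)  = ⊥-elim (subst T eq t)
  bf (suc i , t) = subtype-≡ p (cong (suc ∘ proj₁) (strictlyInverseʳ π (i , t)))

vec↔fin : ∀ n k → Vec (Fin n) k ↔ Fin (n ^ k)
vec↔fin n zero = mk↔ₛ′ (λ _ → zero) (λ _ → []) (λ { zero → refl }) (λ { [] → refl })
vec↔fin n (suc k) = ↔-sym (*↔× {n} {n ^ k}) ↔-∘ mk↔ₛ′
  (λ { (x ∷ xs) → x , to (vec↔fin n k) xs })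
  (λ { (x , j) → x ∷ from (vec↔fin n k) j })
  (λ { (x , j) → cong (x ,_) (strictlyInverseˡ (vec↔fin n k) j) })
  (λ { (x ∷ xs) → cong (x ∷_) (strictlyInverseʳ (vec↔fin n k) xs) })

vec-finite : ∀ {n} k → Finite (Vec (Fin n) k)
vec-finite k = _ , vec↔fin _ k

×-finite : {A B : Set} → Finite A → Finite B → Finite (A × B)
×-finite (a , α) (b , β) = a * b , ↔-sym *↔× ↔-∘ (α ×-↔ β)

finite-all? : {A : Set} → Finite A → {P : A → Set} → (∀ a → Dec (P a)) → Dec (∀ a → P a)
finite-all? (n , α) {P} P? = map′
  (λ h a → subst P (strictlyInverseʳ α a) (h (to α a))) (λ h i → h (from α i))
  (all? (λ i → P? (from α i)))

elements : {A : Set} → Finite A → List A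
elements (n , α) = List.map (from α) (allFin n)

∈-elements : {A : Set} (fin : Finite A) (a : A) → a List.∈ elements fin
∈-elements (n , α) a = subst (List._∈ _) (strictlyInverseʳ α a) (∈-map⁺ (from α) (∈-allFin (to α a)))

-- The search runs over pairs of mutually inverse tables. A function agrees with its decoded table
-- only pointwise, so `Q` has to respect pointwise equality.
bijection? : {A B : Set} → Finite A → Finite B → {Q : (A → B) → Set} →
  (∀ f → Dec (Q f)) → (∀ {f g} → (∀ x → f x ≡ g x) → Q f → Q g) →
  Dec (Σ (A ↔ B) λ π → Q (to π))
bijection? {A} {B} (a , α) (b , β) {Q} Q? resp = map′ fw bw
  (vec-exhaustible any? a λ v → vec-exhaustible any? b λ w →
    all? (λ i → lookup w (lookup v i) ≟ i) ×-dec all? (λ j → lookup v (lookup w j) ≟ j) ×-dec Q? (decode v))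
  where
  decode : Vec (Fin b) a → A → B
  decode v x = from β (lookup v (to α x))
  fw : _ → Σ (A ↔ B) λ π → Q (to π)
  fw (v , w , wv , vw , q) = mk↔ₛ′ (decode v) (λ y → from α (lookup w (to β y)))
    (λ y → trans (cong (from β) (trans (cong (lookup v) (strictlyInverseˡ α _)) (vw _))) (strictlyInverseʳ β y))
    (λ x → trans (cong (from α) (trans (cong (lookup w) (strictlyInverseˡ β _)) (wv _))) (strictlyInverseʳ α x)) , q
  bw : (Σ (A ↔ B) λ π → Q (to π)) → _
  bw (π , q) = v , w
    , (λ i → trans (cong (lookup w) (lv i)) (trans (lw _) (trans
        (cong (to α) (trans (cong (from π) (strictlyInverseʳ β _)) (strictlyInverseʳ π _))) (strictlyInverseˡ α i))))
    , (λ j → trans (cong (lookup v) (lw j)) (trans (lv _) (trans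
        (cong (to β) (trans (cong (to π) (strictlyInverseʳ α _)) (strictlyInverseˡ π _))) (strictlyInverseˡ β j))))
    , resp (λ x → sym (trans (cong (from β) (lv _)) (trans (strictlyInverseʳ β _) (cong (to π) (strictlyInverseʳ α x))))) q
    where
    v = tabulate λ i → to β (to π (from α i))
    w = tabulate λ j → to α (from π (from β j))
    lv : ∀ i → lookup v i ≡ to β (to π (from α i))
    lv = Vec.lookup∘tabulate _
    lw : ∀ j → lookup w j ≡ to α (from π (from β j))
    lw = Vec.lookup∘tabulate _

pointwise-bijection? : {A B : Set} → Finite A → Finite B → {P : A → B → Set} →
  (∀ a b → Dec (P a b)) → Dec (Σ (A ↔ B) λ π → ∀ a → P a (to π a))
pointwise-bijection? fa fb {P} P? = bijection? fa fb
  (λ f → finite-all? fa λ a → P? a (f a)) (λ eq h a → subst (P a) (eq a) (h a))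

iso? : (G H : Graph) → Dec (Iso G H)
iso? G H = bijection? fin-finite fin-finite
  (λ f → all? λ u → all? λ v → adj G u v Bool.≟ adj H (f u) (f v))
  (λ eq h u v → trans (h u v) (cong₂ (adj H) (eq u) (eq v)))

-- Stabilisation and decidability of colour equality.

module Decreasing {A : Set} (fin : Finite A) (R : ℕ → A → Set) (R? : ∀ t a → Dec (R t a))
  (shrink : ∀ t a → R (suc t) a → R t a)
  (propagate : ∀ t → (∀ a → R t a → R (suc t) a) → ∀ a → R (suc t) a → R (suc (suc t)) a) where

  Stable : ℕ → Set
  Stable t = ∀ a → R t a → R (suc t) a

  abstract
    -- The list `xs` covers the relation at round `t`; a round that loses an element shortens the
    -- list.
    stabilises : ∃ Stable
    stabilises = go _ 0 (elements fin) ≤-refl (λ a _ → ∈-elements fin a)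
      where
      go : ∀ fuel t xs → length xs ≤ fuel → (∀ a → R t a → a List.∈ xs) → ∃ Stable
      go fuel t xs le cov with Any.any? (λ a → R? t a ×-dec ¬? (R? (suc t) a)) xs
      ... | no none = t , λ a r → decidable-stable (R? (suc t) a) λ ¬r → none (List.lose (cov a r) (r , ¬r))
      go zero       t (_ ∷ _) () cov | yes lost
      go (suc fuel) t xs le cov | yes lost = go fuel (suc t) (filter (R? (suc t)) xs)
        (≤-pred (≤-trans (filter-notAll (R? (suc t)) xs (Any.map proj₂ lost)) le))
        (λ a r → ∈-filter⁺ (R? (suc t)) (cov a (shrink t a r)) r)

  stable⇒all : ∀ {t} → Stable t → ∀ a → R t a → ∀ t′ → R t′ a
  stable⇒all {t} st a r t′ = down t (subst (λ x → R x a) (+-comm t′ t) (up t′))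
    where
    stable+ : ∀ d → Stable (d + t)
    stable+ zero    = st
    stable+ (suc d) = propagate (d + t) (stable+ d)
    up : ∀ d → R (d + t) a
    up zero    = r
    up (suc d) = stable+ d a (up d)
    down : ∀ d → R (d + t′) a → R t′ a
    down zero    r = r
    down (suc d) r = down d (shrink (d + t′) a r)

-- The refinement condition uniformly in the dimension; `SameColour` unfolds only once it is known
-- whether the dimension is 1.
Refine : ∀ k G H → (Vec (V G) (suc k) → Vec (V H) (suc k) → Set) → Vec (V G) (suc k) → Vec (V H) (suc k) → Set
Refine zero G H R v w = Σ (N G (head v) ↔ N H (head w)) λ π → ∀ x → R Vec.[ proj₁ x ] Vec.[ proj₁ (to π x) ]
Refine (suc k) G H R v w = Σ (V G ↔ V H) λ π → ∀ u i → R (v [ i ]≔ u) (w [ i ]≔ to π u)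

module _ {G H : Graph} where

  SameColour-suc⁻ : ∀ k t {v w} → SameColour (suc k) (suc t) G H v w →
    SameColour (suc k) t G H v w × Refine k G H (SameColour (suc k) t G H) v w
  SameColour-suc⁻ zero    t c = c
  SameColour-suc⁻ (suc k) t c = c

  SameColour-suc⁺ : ∀ k t {v w} →
    SameColour (suc k) t G H v w × Refine k G H (SameColour (suc k) t G H) v w → SameColour (suc k) (suc t) G H v w
  SameColour-suc⁺ zero    t c = c
  SameColour-suc⁺ (suc k) t c = c

  Refine-map : ∀ k {R R′ : Vec (V G) (suc k) → Vec (V H) (suc k) → Set} → (∀ {v w} → R v w → R′ v w) →
    ∀ {v w} → Refine k G H R v w → Refine k G H R′ v w
  Refine-map zero    f (π , h) = π , λ x → f (h x)
  Refine-map (suc k) f (π , h) = π , λ u i → f (h u i)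

  Refine? : ∀ k {R : Vec (V G) (suc k) → Vec (V H) (suc k) → Set} → (∀ v w → Dec (R v w)) →
    ∀ v w → Dec (Refine k G H R v w)
  Refine? zero    R? v w = pointwise-bijection? (subtype-finite (adj G (head v))) (subtype-finite (adj H (head w)))
    λ x y → R? Vec.[ proj₁ x ] Vec.[ proj₁ y ]
  Refine? (suc k) R? v w = pointwise-bijection? fin-finite fin-finite
    λ u u′ → all? λ i → R? (v [ i ]≔ u) (w [ i ]≔ u′)

  AtomEq? : ∀ k v w → Dec (AtomEq k G H v w)
  AtomEq? k v w = all? λ i → all? λ j →
    map′ (λ { (f , g) → mk⇔ f g }) (λ e → Equivalence.to e , Equivalence.from e)
      (((lookup v i ≟ lookup v j) →-dec (lookup w i ≟ lookup w j))
        ×-dec ((lookup w i ≟ lookup w j) →-dec (lookup v i ≟ lookup v j)))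
    ×-dec (adj G (lookup v i) (lookup v j) Bool.≟ adj H (lookup w i) (lookup w j))

  SameColour? : ∀ k t v w → Dec (SameColour (suc k) t G H v w)
  SameColour? k zero    v w = AtomEq? (suc k) v w
  SameColour? k (suc t) v w = map′ (SameColour-suc⁺ k t) (SameColour-suc⁻ k t)
    (SameColour? k t v w ×-dec Refine? k (SameColour? k t) v w)

  SameMultiset? : ∀ k t → Dec (SameMultiset (suc k) t G H)
  SameMultiset? k t = pointwise-bijection? (vec-finite (suc k)) (vec-finite (suc k)) (SameColour? k t)

module Colours (k : ℕ) (G H : Graph) where

  open Decreasing (×-finite (vec-finite (suc k)) (vec-finite (suc k)))
    (λ t (v , w) → SameColour (suc k) t G H v w)
    (λ t (v , w) → SameColour? k t v w)
    (λ t _ c → proj₁ (SameColour-suc⁻ k t c))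
    (λ t st _ c → SameColour-suc⁺ k (suc t) (c , Refine-map k (λ {v} {w} → st (v , w)) (proj₂ (SameColour-suc⁻ k t c))))
    public

  SameMultiset-all : ∀ {t} → Stable t → SameMultiset (suc k) t G H → ∀ t′ → SameMultiset (suc k) t′ G H
  SameMultiset-all st (σ , h) t′ = σ , λ v → stable⇒all st _ (h v) t′

  abstract
    distinguished? : Dec (∃ λ t → ¬ SameMultiset (suc k) t G H)
    distinguished? with stabilises
    ... | t , st with SameMultiset? {G} {H} k t
    ...   | yes same = no λ { (t′ , ¬same) → ¬same (SameMultiset-all st same t′) }
    ...   | no ¬same = yes (t , ¬same)

-- Invariance under isomorphism, and the search for the dimension.

module _ {G H H′ : Graph} (iso : Iso H H′) where

  private
    φ : V H ↔ V H′
    φ = proj₁ iso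

    φ-adj : ∀ u v → adj H u v ≡ adj H′ (to φ u) (to φ v)
    φ-adj = proj₂ iso

    f : V H → V H′
    f = to φ

  neighbours↔ : ∀ w → N H w ↔ N H′ (f w)
  neighbours↔ w = mk↔ₛ′
    (λ { (u , t) → f u , subst T (φ-adj w u) t })
    (λ { (u , t) → from φ u , subst T (trans (cong (adj H′ (f w)) (sym (strictlyInverseˡ φ u))) (sym (φ-adj w _))) t })
    (λ { (u , _) → subtype-≡ (adj H′ (f w)) (strictlyInverseˡ φ u) })
    (λ { (u , _) → subtype-≡ (adj H w) (strictlyInverseʳ φ u) })

  SameColour-iso : ∀ k t {v w} → SameColour (suc k) t G H v w → SameColour (suc k) t G H′ v (Vec.map f w)
  SameColour-iso k zero {v} {w} h i j
    rewrite Vec.lookup-map i f w | Vec.lookup-map j f w =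
      mk⇔ (λ eq → cong f (Equivalence.to (proj₁ (h i j)) eq))
          (λ eq → Equivalence.from (proj₁ (h i j)) (to-injective φ eq))
    , trans (proj₂ (h i j)) (φ-adj _ _)
  SameColour-iso zero (suc t) {w = w ∷ []} (c , π , h) =
    SameColour-iso zero t c , neighbours↔ w ↔-∘ π , λ x → SameColour-iso zero t (h x)
  SameColour-iso (suc k) (suc t) {v} {w} (c , π , h) =
    SameColour-iso (suc k) t c , φ ↔-∘ π , λ u i →
      subst (SameColour (suc (suc k)) t G H′ (v [ i ]≔ u)) (Vec.map-[]≔ f w i) (SameColour-iso (suc k) t (h u i))

  SameMultiset-iso : ∀ k t → SameMultiset (suc k) t G H → SameMultiset (suc k) t G H′
  SameMultiset-iso k t (σ , h) = mk↔ₛ′ (Vec.map f) (Vec.map (from φ))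
      (λ w → inverse-map f (from φ) (strictlyInverseˡ φ) w) (λ w → inverse-map (from φ) f (strictlyInverseʳ φ) w) ↔-∘ σ
    , λ v → SameColour-iso k t (h v)
    where
    inverse-map : {A B : Set} (g : A → B) (g′ : B → A) → (∀ x → g (g′ x) ≡ x) →
      ∀ {n} (xs : Vec B n) → Vec.map g (Vec.map g′ xs) ≡ xs
    inverse-map g g′ eq xs = trans (sym (Vec.map-∘ g g′ xs)) (trans (Vec.map-cong eq xs) (Vec.map-id xs))

Iso-trans : ∀ {G H K} → Iso G H → Iso H K → Iso G K
Iso-trans (φ , φ-adj) (ψ , ψ-adj) = ψ ↔-∘ φ , λ u v → trans (φ-adj u v) (ψ-adj _ _)

Iso-sym : ∀ {G H} → Iso G H → Iso H G
Iso-sym {G} {H} (φ , φ-adj) = ↔-sym φ , λ u v →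
  sym (trans (φ-adj _ _) (cong₂ (adj H) (strictlyInverseˡ φ u) (strictlyInverseˡ φ v)))

Matrix : ℕ → Set
Matrix n = Vec (Vec Bool n) n

module _ {n : ℕ} (1≤n : 1 ≤ n) where

  -- Symmetrising and clearing the diagonal makes every matrix a graph.
  fromMatrix : Matrix n → Graph
  fromMatrix A = record
    { size = n ; nonempty = 1≤n
    ; adj = λ u v → not (does (u ≟ v)) ∧ (entry u v ∨ entry v u)
    ; adj-sym = λ u v → cong₂ _∧_ (cong not (does-sym u v)) (Bool.∨-comm (entry u v) (entry v u))
    ; adj-irr = λ v → cong (λ b → not b ∧ (entry v v ∨ entry v v)) (dec-true (v ≟ v) refl) }
    where
    entry : Fin n → Fin n → Bool
    entry u v = lookup (lookup A u) v
    does-sym : ∀ u v → does (u ≟ v) ≡ does (v ≟ u)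
    does-sym u v with u ≟ v
    ... | yes refl = sym (dec-true (u ≟ u) refl)
    ... | no u≢v   = sym (dec-false (v ≟ u) (u≢v ∘ sym))

fromMatrix-surjective : ∀ {n} (1≤n : 1 ≤ n) (H : Graph) → size H ≡ n → ∃ λ A → Iso H (fromMatrix 1≤n A)
fromMatrix-surjective 1≤n H refl = A , mk↔ₛ′ (λ i → i) (λ i → i) (λ _ → refl) (λ _ → refl) , same
  where
  A = tabulate λ u → tabulate λ v → adj H u v
  entry : ∀ u v → lookup (lookup A u) v ≡ adj H u v
  entry u v = trans (cong (λ r → lookup r v) (Vec.lookup∘tabulate _ u)) (Vec.lookup∘tabulate _ v)
  same : ∀ u v → adj H u v ≡ adj (fromMatrix 1≤n A) u v
  same u v with u ≟ v
  ... | yes refl = adj-irr H u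
  ... | no _ = sym (trans (cong₂ _∨_ (entry u v) (trans (entry v u) (adj-sym H v u))) (Bool.∨-idem _))

size≢⇒¬SameMultiset : ∀ k t {G H} → size H ≢ size G → ¬ SameMultiset (suc k) t G H
size≢⇒¬SameMultiset k t {G} {H} ne (σ , _) with ℕ.<-cmp (size G) (size H)
... | tri< lt _ _ = <⇒≢ (ℕ.^-monoˡ-< (suc k) lt) (↔⇒≡ (vec↔fin _ (suc k) ↔-∘ (σ ↔-∘ ↔-sym (vec↔fin _ (suc k)))))
... | tri≈ _ eq _ = ne (sym eq)
... | tri> _ _ gt = <⇒≢ (ℕ.^-monoˡ-< (suc k) gt) (sym (↔⇒≡ (vec↔fin _ (suc k) ↔-∘ (σ ↔-∘ ↔-sym (vec↔fin _ (suc k))))))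

module _ (k : ℕ) (G : Graph) where

  Counterexample : Matrix (size G) → Set
  Counterexample A = ¬ Iso G H × ¬ ∃ λ t → ¬ SameMultiset (suc k) t G H
    where H = fromMatrix (nonempty G) A

  counterexample? : Dec (∃ Counterexample)
  counterexample? = vec-exhaustible (vec-exhaustible bool-exhaustible (size G)) (size G)
    λ A → let H = fromMatrix (nonempty G) A in ¬? (iso? G H) ×-dec ¬? (Colours.distinguished? k G H)

  -- Graphs of another size differ at round 0 by their number of tuples; those of the same size are
  -- isomorphic to one given by a matrix.
  no-counterexample : ¬ ∃ Counterexample → Identifies (suc k) G
  no-counterexample none H ¬iso = decidable-stable (Colours.distinguished? k G H) λ ¬d → refute ¬d (size H ℕ.≟ size G)
    where
    refute : (¬ ∃ λ t → ¬ SameMultiset (suc k) t G H) → Dec (size H ≡ size G) → ⊥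
    refute ¬d (no ne)  = ¬d (0 , size≢⇒¬SameMultiset k 0 {G} {H} ne)
    refute ¬d (yes eq) = let A , φ = fromMatrix-surjective (nonempty G) H eq in
      none ( A , (λ ψ → ¬iso (Iso-trans {G} {fromMatrix (nonempty G) A} {H} ψ (Iso-sym {H} {fromMatrix (nonempty G) A} φ)))
           , λ { (t , ¬same) → ¬d (t , λ same → ¬same (SameMultiset-iso φ k t same)) })

  identifies? : Dec (Identifies (suc k) G)
  identifies? = map′ no-counterexample
    (λ { ident (A , ¬iso , ¬dist) → ¬dist (ident _ ¬iso) }) (¬? counterexample?)

least : {P : ℕ → Set} → (∀ n → Dec (P n)) → ∀ {n} → P n → ∃ λ m → P m × m ≤ n × (∀ l → l < m → ¬ P l)
least {P} P? {n} pn with below n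
  where
  below : ∀ n → (∃ λ m → P m × m ≤ n × (∀ l → l < m → ¬ P l)) ⊎ (∀ l → l ≤ n → ¬ P l)
  below zero with P? 0
  ... | yes p = inj₁ (0 , p , z≤n , λ _ ())
  ... | no ¬p = inj₂ λ { .0 z≤n → ¬p }
  below (suc n) with below n
  ... | inj₁ (m , p , le , min) = inj₁ (m , p , ℕ.m≤n⇒m≤1+n le , min)
  ... | inj₂ none with P? (suc n)
  ...   | yes p = inj₁ (suc n , p , ≤-refl , λ l l<m → none l (≤-pred l<m))
  ...   | no ¬p = inj₂ λ l le → case l le (ℕ.m≤n⇒m<n∨m≡n le)
    where
    case : ∀ l → l ≤ suc n → l < suc n ⊎ l ≡ suc n → ¬ P l
    case l _ (inj₁ lt) = none l (≤-pred lt)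
    case l _ (inj₂ refl) = ¬p
... | inj₁ found = found
... | inj₂ none  = contradiction pn (none n ≤-refl)

-- From stable colours to the pebble game, and the bound.

distinct-length : ∀ {n} (S : Subset n) (L : List (Fin n)) → AllPairs _≢_ L → All (_∈ S) L → length L ≤ ∣ S ∣
distinct-length S [] [] [] = z≤n
distinct-length S (x ∷ L) (x∉ ∷ ne) (x∈ ∷ L⊆) = ≤-trans
  (s≤s (distinct-length (S - x) L ne (All.zipWith (λ { (x≢y , y∈) → x∈p∧x≢y⇒x∈p-y y∈ (x≢y ∘ sym) }) (x∉ , L⊆))))
  (x∈p⇒∣p-x∣<∣p∣ x∈)

-- Each pair on the board records one index that carries it, so fewer than `k` pairs leave an index
-- to overwrite.
unused-index : ∀ {k} {B : Set} {Q : B → Fin k → Set} {bs : List B} → All (λ b → ∃ (Q b)) bs → length bs < k →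
  ∃ λ j → All (λ b → ∃ λ i → Q b i × i ≢ j) bs
unused-index {k} {Q = Q} {bs} used lt = j , avoid used j∉
  where
  js : ∀ {bs} → All (λ b → ∃ (Q b)) bs → List (Fin k)
  js = All.reduce proj₁
  js-length : ∀ {bs} (us : All (λ b → ∃ (Q b)) bs) → length (js us) ≡ length bs
  js-length [] = refl
  js-length (_ ∷ us) = cong suc (js-length us)
  not-all : ¬ (∀ j → j List.∈ js used)
  not-all all = <⇒≱ lt (≤-trans
    (injective⇒≤ {f = λ j → Any.index (all j)} λ {x} {y} eq →
      trans (lookup-index (all x)) (trans (cong (List.lookup (js used)) eq) (sym (lookup-index (all y)))))
    (≤-reflexive (js-length used)))
  missing : ∃ λ j → ¬ j List.∈ js used
  missing = ¬∀⟶∃¬ k (List._∈ js used) (λ j → DecMembership._∈?_ _≟_ j (js used)) not-all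
  j = proj₁ missing
  j∉ = proj₂ missing
  avoid : ∀ {bs} (us : All (λ b → ∃ (Q b)) bs) → ¬ j List.∈ js us → All (λ b → ∃ λ i → Q b i × i ≢ j) bs
  avoid [] _ = []
  avoid ((i , q) ∷ us) ∉ = (i , q , λ eq → ∉ (here (sym eq))) ∷ avoid us (∉ ∘ there)

module PebbleGame (G H : Graph) (k : ℕ)
  (R : Vec (V G) k → Vec (V H) k → Set)
  (R-atom : ∀ {v w} → R v w → AtomEq k G H v w)
  (R-refine : ∀ {v w} → R v w → Σ (V G ↔ V H) λ π → ∀ u i → R (v [ i ]≔ u) (w [ i ]≔ to π u)) where

  At : Vec (V G) k → Vec (V H) k → V G × V H → Fin k → Set
  At v w p i = lookup v i ≡ proj₁ p × lookup w i ≡ proj₂ p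

  -- Positions are closed under forgetting and reordering pebbles because only the indices of a pair matter.
  E : List (V G × V H) → Set
  E ps = Σ (Vec (V G) k) λ v → Σ (Vec (V H) k) λ w → R v w × All (λ p → ∃ (At v w p)) ps

  ext : ∀ {ps} → E ps → length ps < k → Σ (V G ↔ V H) λ π → ∀ u → E ((u , to π u) ∷ ps)
  ext (v , w , r , used) lt with unused-index used lt | R-refine r
  ... | j , free | π , h = π , λ u →
    v [ j ]≔ u , w [ j ]≔ to π u , h u j
    , (j , Vec.lookup∘update j v u , Vec.lookup∘update j w (to π u))
    ∷ All.map (λ { (i , (a , b) , i≢j) →
        i , trans (Vec.lookup∘update′ i≢j v u) a , trans (Vec.lookup∘update′ i≢j w (to π u)) b }) free

  drop₂ : ∀ {p q ps} → E (p ∷ q ∷ ps) → E (p ∷ ps)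
  drop₂ (v , w , r , a ∷ _ ∷ as) = v , w , r , a ∷ as

  atom : ∀ {a a′ b b′ ps} → E ((a , a′) ∷ (b , b′) ∷ ps) → ((a ≡ b) ⇔ (a′ ≡ b′)) × adj G a b ≡ adj H a′ b′
  atom (v , w , r , (i , refl , refl) ∷ (j , refl , refl) ∷ _) = R-atom r i j

identifies : ∀ G (S : Subset (size G)) → IsVertexCover G S → Identifies (3 + (∣ S ∣ + ∣ S ∣) / 3) G
identifies G S cov H ¬iso = decidable-stable (Colours.distinguished? (2 + (∣ S ∣ + ∣ S ∣) / 3) G H) λ ¬d →
  Game.Cover.isomorphic G H k E ext drop₂ atom (lookup S) cover ∣ S ∣ bound (start ¬d) enough ¬iso
  where
  k = 3 + (∣ S ∣ + ∣ S ∣) / 3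
  open Colours (2 + (∣ S ∣ + ∣ S ∣) / 3) G H
  t = proj₁ stabilises
  stable : Stable t
  stable = proj₂ stabilises
  -- A colour shared at the stable round persists: round 0 gives the atomic agreement, round t + 1
  -- the answering bijection.
  open PebbleGame G H k (SameColour k t G H) (λ c → stable⇒all stable _ c 0) (λ c → proj₂ (stable _ c))
  start : ¬ (∃ λ t → ¬ SameMultiset k t G H) → E []
  start ¬d = let σ , h = decidable-stable (SameMultiset? {G} {H} _ t) (λ ¬same → ¬d (t , ¬same)) in
    -- `E []` asks for one pair of equally coloured tuples; a constant tuple exists as the graph is
    -- non-empty.
    _ , _ , h (replicate _ (fromℕ< (nonempty G))) , []
  cover : ∀ {u v} → adj G u v ≡ true → lookup S u ≡ true ⊎ lookup S v ≡ true
  cover {u} {v} a with cov u v (subst T (sym a) tt)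
  ... | inj₁ u∈ = inj₁ (Vec.[]=⇒lookup u∈)
  ... | inj₂ v∈ = inj₂ (Vec.[]=⇒lookup v∈)
  bound : ∀ L → AllPairs _≢_ L → All (λ v → lookup S v ≡ true) L → length L ≤ ∣ S ∣
  bound L ne L⊆ = distinct-length S L ne (All.map (Vec.lookup⇒[]= _ S) L⊆)
  enough : ∀ l → 3 * l ≤ ∣ S ∣ + ∣ S ∣ → 3 + l ≤ k
  enough l le = +-mono-≤ (≤-refl {3})
    (≤-trans (≤-reflexive (sym (trans (cong (_/ 3) (*-comm 3 l)) (m*n/n≡m l 3)))) (/-monoˡ-≤ 3 le))

theorem3 : (G : Graph) (r : ℕ) → VertexCoverNumber G r →
    Σ ℕ (λ d → IsWLDimension G d × 3 * d ≤ 2 * r + 9)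
theorem3 G r ((S , cov , refl) , _) =
  -- `identifies? k` concerns dimension k + 1, so the search starts at dimension 1 and `m` is the
  -- dimension minus one.
  let m , ident , m≤ , min = least (λ k → identifies? k G) (identifies G S cov)
  in suc m , (s≤s z≤n , ident , λ { (suc l) _ l<m → min l (≤-pred l<m) }) , bound m≤
  where
  q = (∣ S ∣ + ∣ S ∣) / 3
  open ℕ.≤-Reasoning
  bound : ∀ {m} → m ≤ 2 + q → 3 * suc m ≤ 2 * ∣ S ∣ + 9
  bound {m} m≤ = begin
    3 * suc m             ≤⟨ ℕ.*-monoʳ-≤ 3 (s≤s m≤) ⟩
    3 * (3 + q)           ≡⟨ *-distribˡ-+ 3 3 q ⟩
    9 + 3 * q             ≡⟨ +-comm 9 (3 * q) ⟩
    3 * q + 9             ≡⟨ cong (_+ 9) (*-comm 3 q) ⟩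
    q * 3 + 9             ≤⟨ ℕ.+-monoˡ-≤ 9 (m/n*n≤m (∣ S ∣ + ∣ S ∣) 3) ⟩
    ∣ S ∣ + ∣ S ∣ + 9     ≡⟨ cong (λ x → ∣ S ∣ + x + 9) (sym (ℕ.+-identityʳ ∣ S ∣)) ⟩
    2 * ∣ S ∣ + 9         ∎
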